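{- Let $s,t\geq 1$ be integers and let $p,q,l$ be three distinct primes with $p,q$ odd, $p\equiv 3 \pmod 4$, $\mathrm{ord}_{p^s}(l)=\phi(p^s)/2$, $\mathrm{ord}_{q^t}(l)=\phi(q^t)$ and $\gcd(\phi(p^s),\phi(q^t))=2$. Let $0\leq i<i'\leq s-1$ and $0\leq j\leq t-1$. Then in the ring $\mathbb{F}_l[x]/\langle x^{p^sq^t}-1\rangle$: (i) If $q$ is a quadratic residue modulo $p$, then \[\chi_{ij}^*\chi_{i'j}^*=\frac{\phi(p^{s-i'})}{2}(q-2)q^{t-j-1}\chi_{ij}^*+\frac{\phi(p^{s-i'})}{2}\phi(q^{t-j})\sum_{j<m\leq t}\chi_{im}^*.\] (ii) If $q$ is a quadratic nonresidue modulo $p$, then \[ \chi_{ij}^*\chi_{i'j}^*=\frac{\phi(p^{s-i'})}{2}(q-2)q^{t-j-1}\chi_{ij}^*+\frac{\phi(p^{s-i'})}{2}\phi(q^{t-j})\Big(\sum_{\substack{j<m\leq t\\2\nmid m-j}}\chi_{im}+\sum_{\substack{j<m\leq t\\2\mid m-j}}\chi_{im}^*\Big). \]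
   Context: Here $\phi$ is Euler's phi function (with $\phi(1)=1$) and $\mathrm{ord}_m(k)$ is the multiplicative order of $k$ modulo $m$. Put $n=p^sq^t$. Fix an integer $g$ that is a primitive root both modulo $p^s$ and modulo $q^t$. For an integer $\gamma$, $C_\gamma=\{\gamma l^r \bmod n: r\geq 0\}\subseteq \mathbb{Z}_n$ is the $l$-cyclotomic coset modulo $n$ containing $\gamma$. For $0\leq i\leq s$, $0\leq j\leq t$ set $C_{ij}=C_{p^iq^j}$ and $C_{ij}^*=C_{p^iq^jg}$. Define elements of $\mathbb{F}_l[x]/\langle x^{n}-1\rangle$ by $\chi_{ij}=\sum_{\alpha\in C_{ij}}x^\alpha$ and $\chi_{ij}^*=\sum_{\alpha\in C_{ij}^*}x^\alpha$. Integer coefficients are read in $\mathbb{F}_l$, and empty sums are $0$. -}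

module Defs where

open import Algebra.Bundles using (CommutativeRing)
open import Data.Fin.Base as Fin using (Fin; toℕ; fromℕ<)
import Data.Fin.Properties as Fin
open import Data.Integer.Base as ℤ using (ℤ; +_; _+_; _*_; _-_; -_; _^_; 0ℤ; 1ℤ)
open import Data.Integer.Divisibility.Signed using (_∣_; _∣?_; divides; ∣m∣n⇒∣m+n; ∣m⇒∣-m; ∣n⇒∣m*n)
open import Data.Integer.DivMod using (_%ℕ_; _/ℕ_; n%ℕd<d; a≡a%ℕn+[a/ℕn]*n)
import Data.Integer.Properties as ℤ
open import Data.Integer.Tactic.RingSolver using (solve-∀)
open import Data.List.Base using (List; []; _∷_; _++_; map; filter; foldr; length; replicate; allFin; applyUpTo)
open import Data.Nat.Base as ℕ using (ℕ; zero; suc)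
open import Data.Nat.Coprimality using (Coprime; coprime?)
open import Data.Nat.Induction using (<-rec)
import Data.Nat.Properties as ℕ
open import Data.Product using (∃; _×_; _,_)
open import Level using (0ℓ)
open import Relation.Nullary.Decidable using (Dec; yes; no; map′)
open import Relation.Nullary.Negation using (¬_)
open import Relation.Binary.PropositionalEquality using (_≡_; refl; sym; trans; cong; cong₂; subst; module ≡-Reasoning)

infix 4 _≡_[mod_]

record _≡_[mod_] (a b : ℤ) (m : ℕ) : Set where
  constructor congruent
  field modulus∣difference : + m ∣ a - b

open _≡_[mod_] public

module _ {m : ℕ} where

  mod-reflexive : ∀ {a b} → a ≡ b → a ≡ b [mod m ]
  mod-reflexive {a} refl = congruent (divides 0ℤ (ℤ.+-inverseʳ a))

  mod-refl : ∀ {a} → a ≡ a [mod m ]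
  mod-refl = mod-reflexive refl

  mod-sym : ∀ {a b} → a ≡ b [mod m ] → b ≡ a [mod m ]
  mod-sym {a} {b} (congruent d) = congruent (subst (+ m ∣_) (eq a b) (∣m⇒∣-m d))
    where
    eq : ∀ a b → - (a - b) ≡ b - a
    eq = solve-∀

  mod-trans : ∀ {a b c} → a ≡ b [mod m ] → b ≡ c [mod m ] → a ≡ c [mod m ]
  mod-trans {a} {b} {c} (congruent d) (congruent e) =
    congruent (subst (+ m ∣_) (eq a b c) (∣m∣n⇒∣m+n d e))
    where
    eq : ∀ a b c → (a - b) + (b - c) ≡ a - c
    eq = solve-∀

  mod-+-cong : ∀ {a b c d} → a ≡ b [mod m ] → c ≡ d [mod m ] → a + c ≡ b + d [mod m ]
  mod-+-cong {a} {b} {c} {d} (congruent x) (congruent y) =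
    congruent (subst (+ m ∣_) (eq a b c d) (∣m∣n⇒∣m+n x y))
    where
    eq : ∀ a b c d → (a - b) + (c - d) ≡ (a + c) - (b + d)
    eq = solve-∀

  mod-*-cong : ∀ {a b c d} → a ≡ b [mod m ] → c ≡ d [mod m ] → a * c ≡ b * d [mod m ]
  mod-*-cong {a} {b} {c} {d} (congruent x) (congruent y) =
    congruent (subst (+ m ∣_) (eq a b c d) (∣m∣n⇒∣m+n (∣n⇒∣m*n c x) (∣n⇒∣m*n b y)))
    where
    eq : ∀ a b c d → c * (a - b) + b * (c - d) ≡ a * c - b * d
    eq = solve-∀

  mod-neg-cong : ∀ {a b} → a ≡ b [mod m ] → - a ≡ - b [mod m ]
  mod-neg-cong {a} {b} (congruent x) = congruent (subst (+ m ∣_) (eq a b) (∣m⇒∣-m x))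
    where
    eq : ∀ a b → - (a - b) ≡ - a - - b
    eq = solve-∀

mod? : ∀ m a b → Dec (a ≡ b [mod m ])
mod? m a b = map′ congruent modulus∣difference (+ m ∣? a - b)

-- Elements are represented by arbitrary integers, so an integer is read in
-- ℤ/mℤ as itself; for m = l prime this is the field 𝔽ₗ.
ℤ/ : ℕ → CommutativeRing 0ℓ 0ℓ
ℤ/ m = record
  { Carrier = ℤ
  ; _≈_     = _≡_[mod m ]
  ; _+_     = _+_
  ; _*_     = _*_
  ; -_      = -_
  ; 0#      = 0ℤ
  ; 1#      = 1ℤ
  ; isCommutativeRing = record
    { isRing = record
      { +-isAbelianGroup = record
        { isGroup = record
          { isMonoid = record
            { isSemigroup = record
              { isMagma = record
                { isEquivalence = record
                  { refl = mod-refl ; sym = mod-sym ; trans = mod-trans }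
                ; ∙-cong = mod-+-cong
                }
              ; assoc = λ a b c → mod-reflexive (ℤ.+-assoc a b c)
              }
            ; identity = (λ a → mod-reflexive (ℤ.+-identityˡ a))
                       , (λ a → mod-reflexive (ℤ.+-identityʳ a))
            }
          ; inverse = (λ a → mod-reflexive (ℤ.+-inverseˡ a))
                    , (λ a → mod-reflexive (ℤ.+-inverseʳ a))
          ; ⁻¹-cong = mod-neg-cong
          }
        ; comm = λ a b → mod-reflexive (ℤ.+-comm a b)
        }
      ; *-cong = mod-*-cong
      ; *-assoc = λ a b c → mod-reflexive (ℤ.*-assoc a b c)
      ; *-identity = (λ a → mod-reflexive (ℤ.*-identityˡ a))
                   , (λ a → mod-reflexive (ℤ.*-identityʳ a))
      ; distrib = (λ a b c → mod-reflexive (ℤ.*-distribˡ-+ a b c))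
                , (λ a b c → mod-reflexive (ℤ.*-distribʳ-+ a b c))
      }
    ; *-comm = λ a b → mod-reflexive (ℤ.*-comm a b)
    }
  }

φ : ℕ → ℕ
φ n = length (filter (λ k → coprime? k n) (applyUpTo suc n))

-- ord m k ≡ d, as a relation.
record HasOrder (m : ℕ) (k : ℤ) (d : ℕ) : Set where
  field
    positive : 1 ℕ.≤ d
    power≡1  : k ^ d ≡ 1ℤ [mod m ]
    minimal  : ∀ e → 1 ℕ.≤ e → k ^ e ≡ 1ℤ [mod m ] → d ℕ.≤ e

PrimitiveRoot : ℕ → ℤ → Set
PrimitiveRoot m g = HasOrder m g (φ m)

QuadraticResidue : ℕ → ℕ → Set
QuadraticResidue m a = Coprime a m × ∃ λ (x : ℤ) → x ^ 2 ≡ + a [mod m ]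

QuadraticNonresidue : ℕ → ℕ → Set
QuadraticNonresidue m a = Coprime a m × ¬ ∃ λ (x : ℤ) → x ^ 2 ≡ + a [mod m ]

module Polynomial {c ℓ} (R : CommutativeRing c ℓ) where
  private module R = CommutativeRing R

  -- Coefficient lists, constant term first; trailing zeros are permitted,
  -- hence equality is coefficientwise.
  Poly : Set c
  Poly = List R.Carrier

  coeff : Poly → ℕ → R.Carrier
  coeff []      _       = R.0#
  coeff (a ∷ f) zero    = a
  coeff (a ∷ f) (suc k) = coeff f k

  infix  4 _≋_ _≈_[mod⟨_⟩]
  infixl 6 _⊕_ _⊖_
  infixl 7 _⊗_
  infixr 7 _·_

  _≋_ : Poly → Poly → Set ℓ
  f ≋ g = ∀ k → coeff f k R.≈ coeff g k

  _⊕_ : Poly → Poly → Poly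
  []      ⊕ g       = g
  (a ∷ f) ⊕ []      = a ∷ f
  (a ∷ f) ⊕ (b ∷ g) = a R.+ b ∷ f ⊕ g

  _·_ : R.Carrier → Poly → Poly
  a · f = map (a R.*_) f

  _⊖_ : Poly → Poly → Poly
  f ⊖ g = f ⊕ map R.-_ g

  -- (a + x f) g = a g + x (f g)
  _⊗_ : Poly → Poly → Poly
  []      ⊗ g = []
  (a ∷ f) ⊗ g = a · g ⊕ (R.0# ∷ f ⊗ g)

  X^ : ℕ → Poly
  X^ k = replicate k R.0# ++ R.1# ∷ []

  ∑ : ∀ {a} {A : Set a} → List A → (A → Poly) → Poly
  ∑ xs f = foldr (λ x g → f x ⊕ g) [] xs

  -- Equality in the quotient ring R[x]/⟨f⟩.
  _≈_[mod⟨_⟩] : Poly → Poly → Poly → Set _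
  g ≈ h [mod⟨ f ⟩] = ∃ λ k → g ⊖ h ≋ k ⊗ f

-- ℤₙ is Fin n, through the representatives 0, …, n-1.
InCoset : (l n : ℕ) (γ : ℤ) → Fin n → Set
InCoset l n γ α = ∃ λ r → + toℕ α ≡ γ * (+ l) ^ r [mod n ]

-- Membership is decidable because the powers of l modulo n repeat, so that
-- exponents r < n suffice.
module CosetMembership (l n : ℕ) .{{_ : ℕ.NonZero n}} (γ : ℤ) where
  open ≡-Reasoning

  seq : ℕ → ℤ
  seq r = γ * (+ l) ^ r

  residue : ℤ → Fin n
  residue a = fromℕ< (n%ℕd<d a n)

  residue≡⇒mod : ∀ a b → residue a ≡ residue b → a ≡ b [mod n ]
  residue≡⇒mod a b eq = congruent (divides (a /ℕ n - b /ℕ n) (begin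
    a - b
      ≡⟨ cong₂ _-_ (a≡a%ℕn+[a/ℕn]*n a n) (a≡a%ℕn+[a/ℕn]*n b n) ⟩
    (+ (a %ℕ n) + a /ℕ n * + n) - (+ (b %ℕ n) + b /ℕ n * + n)
      ≡⟨ cong (λ u → (+ u + a /ℕ n * + n) - (+ (b %ℕ n) + b /ℕ n * + n)) %-eq ⟩
    (+ (b %ℕ n) + a /ℕ n * + n) - (+ (b %ℕ n) + b /ℕ n * + n)
      ≡⟨ rearrange (+ (b %ℕ n)) (a /ℕ n) (b /ℕ n) (+ n) ⟩
    (a /ℕ n - b /ℕ n) * + n ∎))
    where
    %-eq : a %ℕ n ≡ b %ℕ n
    %-eq = trans (sym (Fin.toℕ-fromℕ< (n%ℕd<d a n)))
                 (trans (cong toℕ eq) (Fin.toℕ-fromℕ< (n%ℕd<d b n)))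
    rearrange : ∀ u x y z → (u + x * z) - (u + y * z) ≡ (x - y) * z
    rearrange = solve-∀

  seq-+ : ∀ a k → seq (a ℕ.+ k) ≡ seq a * (+ l) ^ k
  seq-+ a k = trans (cong (γ *_) (ℤ.^-distribˡ-+-* (+ l) a k))
                    (sym (ℤ.*-assoc γ ((+ l) ^ a) ((+ l) ^ k)))

  shorten : ∀ r → n ℕ.≤ r → ∃ λ r′ → r′ ℕ.< r × seq r ≡ seq r′ [mod n ]
  shorten r n≤r with Fin.pigeonhole (ℕ.n<1+n n) (λ i → residue (seq (toℕ i)))
  ... | i , j , i<j , eq = toℕ i ℕ.+ k , smaller , same
    where
    k = r ℕ.∸ toℕ j
    j+k≡r : toℕ j ℕ.+ k ≡ r
    j+k≡r = ℕ.m+[n∸m]≡n (ℕ.≤-trans (Fin.toℕ≤pred[n] j) n≤r)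
    smaller : toℕ i ℕ.+ k ℕ.< r
    smaller = subst (toℕ i ℕ.+ k ℕ.<_) j+k≡r (ℕ.+-monoˡ-< k i<j)
    i≡j : seq (toℕ i) ≡ seq (toℕ j) [mod n ]
    i≡j = residue≡⇒mod (seq (toℕ i)) (seq (toℕ j)) eq
    same : seq r ≡ seq (toℕ i ℕ.+ k) [mod n ]
    same = mod-trans (mod-reflexive (trans (cong seq (sym j+k≡r)) (seq-+ (toℕ j) k)))
          (mod-trans (mod-*-cong (mod-sym i≡j) (mod-refl {a = (+ l) ^ k}))
                     (mod-reflexive (sym (seq-+ (toℕ i) k))))

  Bounded : ℕ → Set
  Bounded r = ∃ λ (k : Fin n) → seq r ≡ seq (toℕ k) [mod n ]

  bounded : ∀ r → Bounded r
  bounded = <-rec Bounded λ r rec → step r rec (r ℕ.<? n)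
    where
    step : ∀ r → (∀ {r′} → r′ ℕ.< r → Bounded r′) → Dec (r ℕ.< n) → Bounded r
    step r rec (yes r<n) = fromℕ< r<n , mod-reflexive (cong seq (sym (Fin.toℕ-fromℕ< r<n)))
    step r rec (no  r≮n) =
      let r′ , r′<r , e = shorten r (ℕ.≮⇒≥ r≮n)
          k , e′        = rec r′<r
      in k , mod-trans {b = seq r′} e e′

  decide : ∀ α → Dec (InCoset l n γ α)
  decide α = map′ (λ (k , e) → toℕ k , e)
                  (λ (r , e) → let k , e′ = bounded r in k , mod-trans {b = seq r} e e′)
                  (Fin.any? λ k → mod? n (+ toℕ α) (seq (toℕ k)))

inCoset? : ∀ l n γ α → Dec (InCoset l n γ α)
inCoset? l n@(suc _) γ α = CosetMembership.decide l n γ α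

coset : (l n : ℕ) (γ : ℤ) → List (Fin n)
coset l n γ = filter (inCoset? l n γ) (allFin n)

-- ∑_{α ∈ C_γ} x^α over 𝔽ₗ.
cosetSum : (l n : ℕ) (γ : ℤ) → Polynomial.Poly (ℤ/ l)
cosetSum l n γ = ∑ (coset l n γ) (λ α → X^ (toℕ α))
  where open Polynomial (ℤ/ l)

module _ (p q l s t : ℕ) where

  χ : ℕ → ℕ → Polynomial.Poly (ℤ/ l)
  χ i j = cosetSum l (p ℕ.^ s ℕ.* q ℕ.^ t) (+ (p ℕ.^ i ℕ.* q ℕ.^ j))

  χ* : ℤ → ℕ → ℕ → Polynomial.Poly (ℤ/ l)
  χ* g i j = cosetSum l (p ℕ.^ s ℕ.* q ℕ.^ t) (+ (p ℕ.^ i ℕ.* q ℕ.^ j) * g)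

{-# OPTIONS --safe #-}
module Submission where

-- Since gcd(φ(p^s), φ(q^t)) = 2 and φ(p^s)/2 is odd (this is where p ≡ 3 mod 4
-- enters), l generates all pairs (square mod p^s, unit mod q^t).  Hence C_{im} and
-- C*_{im} consist of the p^i q^m u with u a square, resp. a non-square, mod p,
-- and q ∤ u unless m = t.  The coefficient of x^γ in the product counts the
-- decompositions γ = p^i q^j (u + p^{i'-i} v); as i < i', w = u + p^{i'-i} v has
-- the quadratic character of u mod p, and by the Chinese remainder theorem the
-- count is a number of non-squares v mod p^{s-i'} times a number of v mod q^{t-j}
-- with v and w - p^{i'-i} v both prime to q, which depends only on whether q ∣ w.
-- The terms with q ∣ w are split by the power of q dividing w, the quadratic
-- character of the remaining cofactor depending on that of q.
-- The two sides already agree modulo x^n - 1 over the integers.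

-- Generation: the units modulo p^s are the powers of g, and l has half the order of g, so the
-- powers of l are exactly the even powers of g; modulo q^t, l is itself a primitive root. A common
-- divisor of the two orders of l divides 2, so the oddness of one makes them coprime, and exponents
-- prescribed modulo each order can be met at once. Coefficients: v runs modulo p^(s-i') q^(t-j).
-- Half of the units modulo p^(s-i') are non-squares. Modulo q, the residues 0 and w/p^(i'-i) are
-- forbidden for v; they differ when q does not divide w, leaving q - 2, and coincide when it does,
-- leaving q - 1. Passing to q^(t-j) multiplies either count by q^(t-j-1), and the second becomes
-- φ(q^(t-j)). Obstacle: g is given modulo p^s, but a cofactor of p^i q^m is determined only modulo
-- p^(s-i), and u and w are compared only modulo p. The character is therefore defined modulo p, as
-- the parity of an exponent of g; that this parity is well defined rests on raising to the power
-- p^(s-1).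

open import Defs
open import Algebra.Bundles using (CommutativeRing)
open import Data.Fin.Base using (Fin; toℕ; fromℕ<; zero; suc)
import Data.Fin.Properties as Fin
open import Data.Integer.Base as ℤ using (ℤ; +_; 0ℤ; 1ℤ)
open import Data.Integer.Divisibility.Signed as ℤᵈ using () renaming (_∣_ to _∣ᶻ_; _∣?_ to _∣ᶻ?_)
open import Data.Integer.DivMod using (_%ℕ_; _/ℕ_; n%ℕd<d; a≡a%ℕn+[a/ℕn]*n)
import Data.Integer.Properties as ℤ
open import Data.Integer.Tactic.RingSolver using (solve-∀)
open import Data.List.Base using (List; []; _∷_; map; filter; length; lookup; upTo; allFin; applyUpTo; tabulate)
open import Data.List.Membership.Propositional using (_∈_)
open import Data.List.Membership.Propositional.Properties using (∈-applyUpTo⁺; ∈-filter⁺)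
import Data.List.Properties as List
open import Data.List.Relation.Unary.Any using (index)
open import Data.List.Relation.Unary.Any.Properties using (lookup-index)
open import Data.Nat.Base using (ℕ; zero; suc; pred; parity; _+_; _*_; _∸_; _^_; _/_; _%_; _⊔_; _≤_; _<_; s≤s; z≤n; s<s; z<s; NonZero; >-nonZero; >-nonZero⁻¹; nonTrivial⇒≢1; nonTrivial⇒n>1)
open import Data.Nat.Coprimality as Coprime using (Coprime; coprime?; coprime-Bézout; prime⇒coprime)
open import Data.Nat.Divisibility as ℕᵈ using (_∣_; _∣?_)
import Data.Nat.DivMod as ℕ
open import Data.Nat.GCD using (gcd; gcd-greatest; module Bézout)
open import Data.Nat.ListAction using (sum)
open import Data.Nat.Primality using (Prime; irreducible[2]; prime⇒nonZero; prime⇒nonTrivial; prime⇒irreducible)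
open import Data.Nat.Properties as ℕ using (_<?_)
open import Data.Nat.Tactic.RingSolver using () renaming (solve-∀ to ℕ-solve-∀)
open import Data.Parity.Base as ℙ using (Parity; 0ℙ; 1ℙ)
import Data.Parity.Properties as ℙ
open import Data.Product using (_×_; _,_; proj₁; proj₂; ∃; ∃₂)
open import Data.Sum using (_⊎_; inj₁; inj₂)
open import Function.Base using (_∘_; id)
open import Level using (Level)
open import Relation.Binary.PropositionalEquality
import Relation.Binary.Reasoning.Setoid as SetoidReasoning
open import Relation.Nullary.Decidable using (Dec; yes; no; ¬?; _×-dec_; map′)
open import Relation.Nullary.Negation using (¬_; contradiction)

-- Finite sums and indicators

private variable
  ℓ₁ ℓ₂ ℓ₃ : Level
  Φ : Set ℓ₁
  Ψ : Set ℓ₂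
  Θ : Set ℓ₃

-- Cardinalities are sums of these indicators. The value depends on the decision procedure only
-- through the proposition (`⟦⟧-cong`), so different procedures for the same set are
-- interchangeable.
⟦_⟧ : Dec Φ → ℕ
⟦ yes _ ⟧ = 1
⟦ no _ ⟧  = 0

⟦⟧-true : (p? : Dec Φ) → Φ → ⟦ p? ⟧ ≡ 1
⟦⟧-true (yes _) p = refl
⟦⟧-true (no ¬p) p = contradiction p ¬p

⟦⟧-false : (p? : Dec Φ) → ¬ Φ → ⟦ p? ⟧ ≡ 0
⟦⟧-false (yes p) ¬p = contradiction p ¬p
⟦⟧-false (no _)  ¬p = refl

⟦⟧-¬ : (p? : Dec Φ) → ⟦ p? ⟧ + ⟦ ¬? p? ⟧ ≡ 1
⟦⟧-¬ (yes _) = refl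
⟦⟧-¬ (no _)  = refl

⟦⟧-cong : (Φ → Ψ) → (Ψ → Φ) → (p? : Dec Φ) (q? : Dec Ψ) → ⟦ p? ⟧ ≡ ⟦ q? ⟧
⟦⟧-cong f g (yes p) q? = sym (⟦⟧-true q? (f p))
⟦⟧-cong f g (no ¬p) q? with q?
... | yes q = contradiction (g q) ¬p
... | no _  = refl

⟦⟧-× : (p? : Dec Φ) (q? : Dec Ψ) → ⟦ p? ×-dec q? ⟧ ≡ ⟦ p? ⟧ * ⟦ q? ⟧
⟦⟧-× (yes _) (yes _) = refl
⟦⟧-× (yes _) (no _)  = refl
⟦⟧-× (no _)  _       = refl

⟦⟧-*-zero : (p? : Dec Φ) (q? : Dec Ψ) → (Φ → ¬ Ψ) → ⟦ p? ⟧ * ⟦ q? ⟧ ≡ 0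
⟦⟧-*-zero (yes p) q? ¬pq = trans (ℕ.+-identityʳ _) (⟦⟧-false q? (¬pq p))
⟦⟧-*-zero (no _)  q? ¬pq = refl

⟦⟧-split : (p? : Dec Φ) (q? : Dec Ψ) (r? : Dec Θ) →
  (Ψ → Φ) → (Θ → Φ) → (Φ → ¬ Θ → Ψ) → (Ψ → ¬ Θ) → ⟦ q? ⟧ + ⟦ r? ⟧ ≡ ⟦ p? ⟧
⟦⟧-split p? (yes q) (yes r) q⇒p r⇒p p⇒q q⇒¬r = contradiction r (q⇒¬r q)
⟦⟧-split p? (yes q) (no _)  q⇒p r⇒p p⇒q q⇒¬r = sym (⟦⟧-true p? (q⇒p q))
⟦⟧-split p? (no _)  (yes r) q⇒p r⇒p p⇒q q⇒¬r = sym (⟦⟧-true p? (r⇒p r))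
⟦⟧-split p? (no ¬q) (no ¬r) q⇒p r⇒p p⇒q q⇒¬r = sym (⟦⟧-false p? λ p → ¬q (p⇒q p ¬r))

S : ℕ → (ℕ → ℕ) → ℕ
S n f = sum (applyUpTo f n)

S-cong< : ∀ n {f g} → (∀ {k} → k < n → f k ≡ g k) → S n f ≡ S n g
S-cong< zero    eq = refl
S-cong< (suc n) eq = cong₂ _+_ (eq z<s) (S-cong< n (eq ∘ s<s))

S-cong : ∀ n {f g} → (∀ k → f k ≡ g k) → S n f ≡ S n g
S-cong n eq = S-cong< n (λ {k} _ → eq k)

S-const : ∀ n c → S n (λ _ → c) ≡ n * c
S-const zero    c = refl
S-const (suc n) c = cong (_+_ c) (S-const n c)

S-+ : ∀ n f g → S n (λ k → f k + g k) ≡ S n f + S n g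
S-+ zero    f g = refl
S-+ (suc n) f g = trans (cong (_+_ _) (S-+ n (f ∘ suc) (g ∘ suc)))
  (interchange (f 0) (g 0) (S n (f ∘ suc)) (S n (g ∘ suc)))
  where
  interchange : ∀ a b c d → a + b + (c + d) ≡ a + c + (b + d)
  interchange = ℕ-solve-∀

S-*ˡ : ∀ n c f → S n (λ k → c * f k) ≡ c * S n f
S-*ˡ zero    c f = sym (ℕ.*-zeroʳ c)
S-*ˡ (suc n) c f = trans (cong (_+_ (c * f 0)) (S-*ˡ n c (f ∘ suc))) (sym (ℕ.*-distribˡ-+ c (f 0) _))

S-swap : ∀ m n (f : ℕ → ℕ → ℕ) → S m (λ x → S n (f x)) ≡ S n (λ y → S m (λ x → f x y))
S-swap zero    n f = sym (trans (S-const n 0) (ℕ.*-zeroʳ n))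
S-swap (suc m) n f = trans (cong (_+_ (S n (f 0))) (S-swap m n (f ∘ suc))) (sym (S-+ n (f 0) _))

S-++ : ∀ m n f → S (m + n) f ≡ S m f + S n (λ k → f (m + k))
S-++ zero    n f = refl
S-++ (suc m) n f = trans (cong (_+_ (f 0)) (S-++ m n (f ∘ suc))) (sym (ℕ.+-assoc (f 0) _ _))

S-suc : ∀ n f → S (suc n) f ≡ S n f + f n
S-suc zero    f = ℕ.+-identityʳ (f 0)
S-suc (suc n) f = trans (cong (_+_ (f 0)) (S-suc n (f ∘ suc))) (sym (ℕ.+-assoc (f 0) _ _))

S-* : ∀ m n f → S (m * n) f ≡ S m (λ y → S n (λ x → f (y * n + x)))
S-* zero    n f = refl
S-* (suc m) n f = trans (S-++ n (m * n) f) (cong (_+_ (S n f)) (trans (S-* m n _)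
  (S-cong m λ y → S-cong n λ x → cong f (sym (ℕ.+-assoc n (y * n) x)))))

S-zero : ∀ n {f} → (∀ {k} → k < n → f k ≡ 0) → S n f ≡ 0
S-zero n eq = trans (S-cong< n eq) (trans (S-const n 0) (ℕ.*-zeroʳ n))

S-single : ∀ n {f k₀} → k₀ < n → (∀ {k} → k < n → k ≢ k₀ → f k ≡ 0) → S n f ≡ f k₀
S-single (suc n) {f} {zero}   _         eq =
  trans (cong (_+_ (f 0)) (S-zero n (λ k<n → eq (s<s k<n) (λ ())))) (ℕ.+-identityʳ (f 0))
S-single (suc n) {f} {suc k₀} (s≤s k₀<n) eq =
  cong₂ _+_ (eq z<s (λ ())) (S-single n k₀<n (λ k<n k≢k₀ → eq (s<s k<n) (k≢k₀ ∘ ℕ.suc-injective)))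

module _ {a} {A : Set a} where

  sum-map-filter : ∀ {p} {P : A → Set p} (P? : ∀ x → Dec (P x)) (f : A → ℕ) xs →
    sum (map f (filter P? xs)) ≡ sum (map (λ x → ⟦ P? x ⟧ * f x) xs)
  sum-map-filter P? f []       = refl
  sum-map-filter P? f (x ∷ xs) with P? x
  ... | yes _ = cong₂ _+_ (sym (ℕ.*-identityˡ (f x))) (sum-map-filter P? f xs)
  ... | no _  = sum-map-filter P? f xs

  length≡sum : (xs : List A) → length xs ≡ sum (map (λ _ → 1) xs)
  length≡sum []       = refl
  length≡sum (x ∷ xs) = cong suc (length≡sum xs)

sum-tabulate : ∀ n (f : ℕ → ℕ) (g : Fin n → ℕ) → (∀ x → g x ≡ f (toℕ x)) → sum (tabulate g) ≡ S n f
sum-tabulate zero    f g eq = refl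
sum-tabulate (suc n) f g eq = cong₂ _+_ (eq zero) (sum-tabulate n (f ∘ suc) (g ∘ suc) (eq ∘ suc))

sum-allFin : ∀ n (f : ℕ → ℕ) (g : Fin n → ℕ) → (∀ x → g x ≡ f (toℕ x)) → sum (map g (allFin n)) ≡ S n f
sum-allFin n f g eq = trans (cong sum (List.map-tabulate id g)) (sum-tabulate n f g eq)

sum-upTo : ∀ n f → sum (map f (upTo n)) ≡ S n f
sum-upTo n f = cong sum (List.map-upTo f n)

-- Congruences and sums of periodic functions

∣-comb : ∀ {m A B} u v → m ∣ᶻ A → m ∣ᶻ B → m ∣ᶻ u ℤ.* A ℤ.+ v ℤ.* B
∣-comb u v d e = ℤᵈ.∣m∣n⇒∣m+n (ℤᵈ.∣n⇒∣m*n u d) (ℤᵈ.∣n⇒∣m*n v e)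

+-∣ : ∀ {m n} → m ∣ n → + m ∣ᶻ + n
+-∣ = ℤᵈ.∣ᵤ⇒∣

mod-∣ : ∀ {m n a b} → m ∣ n → a ≡ b [mod n ] → a ≡ b [mod m ]
mod-∣ m∣n (congruent n∣a-b) = congruent (ℤᵈ.∣-trans (+-∣ m∣n) n∣a-b)

mod-*-congˡ : ∀ {m} a {b c} → b ≡ c [mod m ] → a ℤ.* b ≡ a ℤ.* c [mod m ]
mod-*-congˡ a = mod-*-cong (mod-refl {a = a})

mod-*-congʳ : ∀ {m} c {a b} → a ≡ b [mod m ] → a ℤ.* c ≡ b ℤ.* c [mod m ]
mod-*-congʳ c a≡b = mod-*-cong a≡b (mod-refl {a = c})

mod-^-cong : ∀ {m a b} k → a ≡ b [mod m ] → a ℤ.^ k ≡ b ℤ.^ k [mod m ]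
mod-^-cong zero    a≡b = mod-refl
mod-^-cong (suc k) a≡b = mod-*-cong a≡b (mod-^-cong k a≡b)

∣-resp-mod : ∀ {m n a b} → m ∣ n → a ≡ b [mod n ] → + m ∣ᶻ a → + m ∣ᶻ b
∣-resp-mod {a = a} {b} m∣n a≡b m∣a =
  subst (_ ∣ᶻ_) (eq a b) (ℤᵈ.∣m∣n⇒∣m-n m∣a (modulus∣difference (mod-∣ m∣n a≡b)))
  where
  eq : ∀ a b → a ℤ.- (a ℤ.- b) ≡ b
  eq = solve-∀

mod-+multiple : ∀ {m} a y → a ℤ.+ + m ℤ.* y ≡ a [mod m ]
mod-+multiple {m} a y = congruent (ℤᵈ.divides y (eq a (+ m) y))
  where
  eq : ∀ a m y → a ℤ.+ m ℤ.* y ℤ.- a ≡ y ℤ.* m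
  eq = solve-∀

mod-% : ∀ n .{{_ : NonZero n}} a → a ≡ + (a %ℕ n) [mod n ]
mod-% n a = mod-trans (mod-reflexive (trans (a≡a%ℕn+[a/ℕn]*n a n)
  (cong (ℤ._+_ (+ (a %ℕ n))) (ℤ.*-comm (a /ℕ n) (+ n))))) (mod-+multiple (+ (a %ℕ n)) (a /ℕ n))

-- The difference is a multiple of n of absolute value at most max(k, k′) < n, hence 0.
mod⇒≡ : ∀ {n k k′} → k < n → k′ < n → + k ≡ + k′ [mod n ] → k ≡ k′
mod⇒≡ {n} {k} {k′} k<n k′<n (congruent n∣k-k′) =
  ℤ.+-injective (ℤ.i-j≡0⇒i≡j (+ k) (+ k′) (ℤ.∣i∣≡0⇒i≡0 (small _ (ℤᵈ.∣⇒∣ᵤ n∣k-k′) <n)))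
  where
  small : ∀ d → n ∣ d → d < n → d ≡ 0
  small zero    _   _   = refl
  small (suc d) n∣d d<n = contradiction n∣d (ℕᵈ.>⇒∤ d<n)
  <n : ℤ.∣ + k ℤ.- + k′ ∣ < n
  <n = ℕ.≤-<-trans (subst (_≤ k ⊔ k′) (cong ℤ.∣_∣ (sym (ℤ.m-n≡m⊖n k k′))) (ℤ.∣m⊝n∣≤m⊔n k k′))
                   (ℕ.⊔-lub k<n k′<n)

-- An explicit inverse, rather than coprimality, makes sense for every integer c and can enter
-- directly into the linear combinations that certify divisibility.
record Unit (m : ℕ) (c : ℤ) : Set where
  constructor unit
  field
    inverse   : ℤ
    *-inverse : c ℤ.* inverse ≡ 1ℤ [mod m ]

Unit-* : ∀ {m a b} → Unit m a → Unit m b → Unit m (a ℤ.* b)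
Unit-* {a = a} {b} (unit a′ p) (unit b′ q) = unit (a′ ℤ.* b′)
  (mod-trans (mod-reflexive (eq a b a′ b′)) (mod-*-cong p q))
  where
  eq : ∀ a b a′ b′ → a ℤ.* b ℤ.* (a′ ℤ.* b′) ≡ a ℤ.* a′ ℤ.* (b ℤ.* b′)
  eq = solve-∀

Unit-^ : ∀ {m a} k → Unit m a → Unit m (a ℤ.^ k)
Unit-^ zero    u = unit 1ℤ mod-refl
Unit-^ (suc k) u = Unit-* u (Unit-^ k u)

Unit-resp : ∀ {m a b} → a ≡ b [mod m ] → Unit m a → Unit m b
Unit-resp a≡b (unit a′ p) = unit a′ (mod-trans (mod-*-congʳ a′ (mod-sym a≡b)) p)

Coprime⇒Unit : ∀ {m k} → Coprime k m → Unit m (+ k)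
Coprime⇒Unit {m} {k} c with coprime-Bézout c
... | Bézout.+- x y eq = unit (+ x) (mod-trans (mod-reflexive lemma) (mod-+multiple 1ℤ (+ y)))
  where
  open ≡-Reasoning
  lemma : + k ℤ.* + x ≡ 1ℤ ℤ.+ + m ℤ.* + y
  lemma = begin
    + k ℤ.* + x        ≡⟨ sym (ℤ.pos-* k x) ⟩
    + (k * x)          ≡⟨ cong +_ (trans (ℕ.*-comm k x) (trans (sym eq) (cong suc (ℕ.*-comm y m)))) ⟩
    + (1 + m * y)      ≡⟨ cong (ℤ._+_ 1ℤ) (ℤ.pos-* m y) ⟩
    1ℤ ℤ.+ + m ℤ.* + y ∎
... | Bézout.-+ x y eq = unit (ℤ.- + x) (mod-trans (mod-reflexive lemma) (mod-+multiple 1ℤ (ℤ.- + y)))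
  where
  open ≡-Reasoning
  move : ∀ a b → ℤ.- a ≡ 1ℤ ℤ.- (1ℤ ℤ.+ a)
  move = solve-∀
  sign : ∀ m y → 1ℤ ℤ.- y ℤ.* m ≡ 1ℤ ℤ.+ m ℤ.* ℤ.- y
  sign = solve-∀
  lemma : + k ℤ.* ℤ.- + x ≡ 1ℤ ℤ.+ + m ℤ.* ℤ.- + y
  lemma = begin
    + k ℤ.* ℤ.- + x           ≡⟨ sym (ℤ.neg-distribʳ-* (+ k) (+ x)) ⟩
    ℤ.- (+ k ℤ.* + x)         ≡⟨ cong ℤ.-_ (trans (sym (ℤ.pos-* k x)) (cong +_ (ℕ.*-comm k x))) ⟩
    ℤ.- + (x * k)             ≡⟨ move (+ (x * k)) 0ℤ ⟩
    1ℤ ℤ.- + (1 + x * k)      ≡⟨ cong (λ z → 1ℤ ℤ.- + z) eq ⟩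
    1ℤ ℤ.- + (y * m)          ≡⟨ cong (ℤ._-_ 1ℤ) (ℤ.pos-* y m) ⟩
    1ℤ ℤ.- + y ℤ.* + m        ≡⟨ sign (+ m) (+ y) ⟩
    1ℤ ℤ.+ + m ℤ.* ℤ.- + y    ∎

Unit⇒∤ : ∀ {m n c} → m ≢ 1 → m ∣ n → Unit n c → ¬ + m ∣ᶻ c
Unit⇒∤ m≢1 m∣n (unit c′ cc′≡1) m∣c =
  m≢1 (ℕᵈ.∣1⇒≡1 (ℤᵈ.∣⇒∣ᵤ (∣-resp-mod m∣n cc′≡1 (ℤᵈ.∣m⇒∣m*n c′ m∣c))))

Unit⇒Coprime : ∀ {m k} → Unit m (+ k) → Coprime k m
Unit⇒Coprime u {d} (d∣k , d∣m) with d ℕ.≟ 1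
... | yes d≡1 = d≡1
... | no  d≢1 = contradiction (+-∣ d∣k) (Unit⇒∤ d≢1 d∣m u)

-- A function on ℤ/n is encoded as a periodic function on ℤ, summed over the representatives 0, ...,
-- n-1.
Periodic : ℕ → (ℤ → ℕ) → Set
Periodic n h = ∀ {a b} → a ≡ b [mod n ] → h a ≡ h b

Periodic-∣ : ∀ {m n h} → m ∣ n → Periodic m h → Periodic n h
Periodic-∣ m∣n per = per ∘ mod-∣ m∣n

-- Only the representative `a %ℕ n` contributes. Read backwards, this expands a value of h into
-- point masses, which turns substitutions into exchanges of sums.
S-pick : ∀ n .{{_ : NonZero n}} {h} → Periodic n h → ∀ a →
  S n (λ z → ⟦ mod? n (+ z) a ⟧ * h (+ z)) ≡ h a
S-pick n {h} per a = begin
  S n (λ z → ⟦ mod? n (+ z) a ⟧ * h (+ z)) ≡⟨ S-single n (n%ℕd<d a n) (λ {k} k<n k≢ →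
    cong (_* h (+ k)) (⟦⟧-false (mod? n (+ k) a)
      λ k≡a → k≢ (mod⇒≡ k<n (n%ℕd<d a n) (mod-trans k≡a (mod-% n a))))) ⟩
  ⟦ mod? n (+ r) a ⟧ * h (+ r)             ≡⟨ cong (_* h (+ r)) (⟦⟧-true (mod? n (+ r) a) (mod-sym (mod-% n a))) ⟩
  1 * h (+ r)                              ≡⟨ ℕ.*-identityˡ _ ⟩
  h (+ r)                                  ≡⟨ per (mod-sym (mod-% n a)) ⟩
  h a                                      ∎
  where
  open ≡-Reasoning
  r = a %ℕ n

-- The unique solution is y ≡ c′ (a - x), with c′ the inverse of c.
S-solutions : ∀ n .{{_ : NonZero n}} {c} → Unit n c → ∀ a x →
  S n (λ y → ⟦ mod? n a (x ℤ.+ c ℤ.* + y) ⟧) ≡ 1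
S-solutions n {c} (unit c′ (congruent cc′≡1)) a x = trans
  (S-cong n λ y → trans (⟦⟧-cong (to (+ y)) (from (+ y)) (mod? n a _) (mod? n (+ y) (c′ ℤ.* (a ℤ.- x))))
                        (sym (ℕ.*-identityʳ _)))
  (S-pick n {λ _ → 1} (λ _ → refl) (c′ ℤ.* (a ℤ.- x)))
  where
  to : ∀ y → a ≡ x ℤ.+ c ℤ.* y [mod n ] → y ≡ c′ ℤ.* (a ℤ.- x) [mod n ]
  to y (congruent d) = congruent (subst (+ n ∣ᶻ_) (eq a x c c′ y) (∣-comb (ℤ.- c′) (ℤ.- y) d cc′≡1))
    where
    eq : ∀ a x c c′ y → ℤ.- c′ ℤ.* (a ℤ.- (x ℤ.+ c ℤ.* y)) ℤ.+ ℤ.- y ℤ.* (c ℤ.* c′ ℤ.- 1ℤ)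
                        ≡ y ℤ.- c′ ℤ.* (a ℤ.- x)
    eq = solve-∀
  from : ∀ y → y ≡ c′ ℤ.* (a ℤ.- x) [mod n ] → a ≡ x ℤ.+ c ℤ.* y [mod n ]
  from y (congruent d) = congruent (subst (+ n ∣ᶻ_) (eq a x c c′ y) (∣-comb (ℤ.- c) (x ℤ.- a) d cc′≡1))
    where
    eq : ∀ a x c c′ y → ℤ.- c ℤ.* (y ℤ.- c′ ℤ.* (a ℤ.- x)) ℤ.+ (x ℤ.- a) ℤ.* (c ℤ.* c′ ℤ.- 1ℤ)
                        ≡ a ℤ.- (x ℤ.+ c ℤ.* y)
    eq = solve-∀

-- The map y ↦ x + c y permutes ℤ/n. No bijection is built: h is expanded into point masses, the
-- sums are exchanged, and every z is left with exactly one solution y.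
S-affine : ∀ n .{{_ : NonZero n}} {h} → Periodic n h → ∀ {c} → Unit n c → ∀ x →
  S n (λ y → h (x ℤ.+ c ℤ.* + y)) ≡ S n (λ y → h (+ y))
S-affine n {h} per {c} u x = begin
  S n (λ y → h (x ℤ.+ c ℤ.* + y))
    ≡⟨ S-cong n (λ y → sym (S-pick n per _)) ⟩
  S n (λ y → S n (λ z → ⟦ mod? n (+ z) (x ℤ.+ c ℤ.* + y) ⟧ * h (+ z)))
    ≡⟨ S-swap n n _ ⟩
  S n (λ z → S n (λ y → ⟦ mod? n (+ z) (x ℤ.+ c ℤ.* + y) ⟧ * h (+ z)))
    ≡⟨ S-cong n (λ z → trans (S-cong n (λ y → ℕ.*-comm _ (h (+ z)))) (S-*ˡ n (h (+ z)) _)) ⟩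
  S n (λ z → h (+ z) * S n (λ y → ⟦ mod? n (+ z) (x ℤ.+ c ℤ.* + y) ⟧))
    ≡⟨ S-cong n (λ z → trans (cong (h (+ z) *_) (S-solutions n u (+ z) x)) (ℕ.*-identityʳ _)) ⟩
  S n (λ z → h (+ z)) ∎
  where open ≡-Reasoning

mod-block : ∀ n y x → + (y * n + x) ≡ + x [mod n ]
mod-block n y x = mod-trans (mod-reflexive (begin
  + (y * n + x)       ≡⟨ cong +_ (ℕ.+-comm (y * n) x) ⟩
  + x ℤ.+ + (y * n)   ≡⟨ cong (ℤ._+_ (+ x)) (trans (cong +_ (ℕ.*-comm y n)) (ℤ.pos-* n y)) ⟩
  + x ℤ.+ + n ℤ.* + y ∎)) (mod-+multiple (+ x) (+ y))
  where open ≡-Reasoning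

S-periods : ∀ m n {h} → Periodic n h → S (m * n) (λ y → h (+ y)) ≡ m * S n (λ y → h (+ y))
S-periods m n {h} per = trans (S-* m n _)
  (trans (S-cong m λ y → S-cong n λ x → per (mod-block n y x)) (S-const m _))

-- Write k = y p + x with x < p. Then F sees only x, while for fixed x the values x + p y run once
-- through the residues modulo q because p is invertible there.
S-CRT : ∀ p q .{{_ : NonZero q}} {F G} → Periodic p F → Periodic q G → Unit q (+ p) →
  S (q * p) (λ k → F (+ k) * G (+ k)) ≡ S p (λ k → F (+ k)) * S q (λ k → G (+ k))
S-CRT p q {F} {G} perF perG u = begin
  S (q * p) (λ k → F (+ k) * G (+ k))
    ≡⟨ S-* q p _ ⟩
  S q (λ y → S p (λ x → F (+ (y * p + x)) * G (+ (y * p + x))))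
    ≡⟨ S-swap q p _ ⟩
  S p (λ x → S q (λ y → F (+ (y * p + x)) * G (+ (y * p + x))))
    ≡⟨ S-cong p (λ x → trans (S-cong q λ y → cong₂ _*_ (perF (mod-block p y x)) (cong G (affine x y)))
                      (trans (S-*ˡ q (F (+ x)) _) (cong (F (+ x) *_) (S-affine q perG u (+ x))))) ⟩
  S p (λ x → F (+ x) * S q (λ k → G (+ k)))
    ≡⟨ trans (S-cong p λ x → ℕ.*-comm (F (+ x)) _) (trans (S-*ˡ p (S q (λ k → G (+ k))) _) (ℕ.*-comm _ (S p (λ k → F (+ k))))) ⟩
  S p (λ k → F (+ k)) * S q (λ k → G (+ k)) ∎
  where
  open ≡-Reasoning
  affine : ∀ x y → + (y * p + x) ≡ + x ℤ.+ + p ℤ.* + y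
  affine x y = trans (cong +_ (ℕ.+-comm (y * p) x))
    (cong (ℤ._+_ (+ x)) (trans (cong +_ (ℕ.*-comm y p)) (ℤ.pos-* p y)))

-- Integer coefficients modulo x^n - 1

module _ (l : ℕ) where
  open Polynomial (ℤ/ l)

  coeff-⊕ : ∀ f g k → coeff (f ⊕ g) k ≡ coeff f k ℤ.+ coeff g k
  coeff-⊕ []      g       k       = sym (ℤ.+-identityˡ _)
  coeff-⊕ (a ∷ f) []      k       = sym (ℤ.+-identityʳ _)
  coeff-⊕ (a ∷ f) (b ∷ g) zero    = refl
  coeff-⊕ (a ∷ f) (b ∷ g) (suc k) = coeff-⊕ f g k

  coeff-· : ∀ a f k → coeff (a · f) k ≡ a ℤ.* coeff f k
  coeff-· a []      k       = sym (ℤ.*-zeroʳ a)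
  coeff-· a (b ∷ f) zero    = refl
  coeff-· a (b ∷ f) (suc k) = coeff-· a f k

  coeff-neg : ∀ f k → coeff (map ℤ.-_ f) k ≡ ℤ.- coeff f k
  coeff-neg []      k       = refl
  coeff-neg (b ∷ f) zero    = refl
  coeff-neg (b ∷ f) (suc k) = coeff-neg f k

  coeff-∷⊗ : ∀ a f g k → coeff ((a ∷ f) ⊗ g) k ≡ a ℤ.* coeff g k ℤ.+ coeff (0ℤ ∷ f ⊗ g) k
  coeff-∷⊗ a f g k = trans (coeff-⊕ (a · g) _ k) (cong (ℤ._+ _) (coeff-· a g k))

  ∷-cong : ∀ {f g} → (∀ k → coeff f k ≡ coeff g k) → ∀ k → coeff (0ℤ ∷ f) k ≡ coeff (0ℤ ∷ g) k
  ∷-cong eq zero    = refl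
  ∷-cong eq (suc k) = eq k

  ⊗-distribʳ-⊕ : ∀ h f g k → coeff ((f ⊕ g) ⊗ h) k ≡ coeff (f ⊗ h) k ℤ.+ coeff (g ⊗ h) k
  ⊗-distribʳ-⊕ h []      g       k = sym (ℤ.+-identityˡ _)
  ⊗-distribʳ-⊕ h (a ∷ f) []      k = sym (ℤ.+-identityʳ _)
  ⊗-distribʳ-⊕ h (a ∷ f) (b ∷ g) k = begin
    coeff ((a ℤ.+ b ∷ f ⊕ g) ⊗ h) k
      ≡⟨ coeff-∷⊗ (a ℤ.+ b) (f ⊕ g) h k ⟩
    (a ℤ.+ b) ℤ.* coeff h k ℤ.+ coeff (0ℤ ∷ (f ⊕ g) ⊗ h) k
      ≡⟨ cong (ℤ._+_ ((a ℤ.+ b) ℤ.* coeff h k)) (shift k) ⟩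
    (a ℤ.+ b) ℤ.* coeff h k ℤ.+ (coeff (0ℤ ∷ f ⊗ h) k ℤ.+ coeff (0ℤ ∷ g ⊗ h) k)
      ≡⟨ eq a b (coeff h k) _ _ ⟩
    (a ℤ.* coeff h k ℤ.+ coeff (0ℤ ∷ f ⊗ h) k) ℤ.+ (b ℤ.* coeff h k ℤ.+ coeff (0ℤ ∷ g ⊗ h) k)
      ≡⟨ sym (cong₂ ℤ._+_ (coeff-∷⊗ a f h k) (coeff-∷⊗ b g h k)) ⟩
    coeff ((a ∷ f) ⊗ h) k ℤ.+ coeff ((b ∷ g) ⊗ h) k ∎
    where
    open ≡-Reasoning
    eq : ∀ a b c x y → (a ℤ.+ b) ℤ.* c ℤ.+ (x ℤ.+ y) ≡ (a ℤ.* c ℤ.+ x) ℤ.+ (b ℤ.* c ℤ.+ y)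
    eq = solve-∀
    shift : ∀ k → coeff (0ℤ ∷ (f ⊕ g) ⊗ h) k ≡ coeff (0ℤ ∷ f ⊗ h) k ℤ.+ coeff (0ℤ ∷ g ⊗ h) k
    shift zero    = refl
    shift (suc k) = ⊗-distribʳ-⊕ h f g k

  ⊗-distribˡ-⊕ : ∀ h f g k → coeff (h ⊗ (f ⊕ g)) k ≡ coeff (h ⊗ f) k ℤ.+ coeff (h ⊗ g) k
  ⊗-distribˡ-⊕ []      f g k = refl
  ⊗-distribˡ-⊕ (a ∷ h) f g k = begin
    coeff ((a ∷ h) ⊗ (f ⊕ g)) k
      ≡⟨ coeff-∷⊗ a h (f ⊕ g) k ⟩
    a ℤ.* coeff (f ⊕ g) k ℤ.+ coeff (0ℤ ∷ h ⊗ (f ⊕ g)) k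
      ≡⟨ cong₂ (λ u v → a ℤ.* u ℤ.+ v) (coeff-⊕ f g k) (shift k) ⟩
    a ℤ.* (coeff f k ℤ.+ coeff g k) ℤ.+ (coeff (0ℤ ∷ h ⊗ f) k ℤ.+ coeff (0ℤ ∷ h ⊗ g) k)
      ≡⟨ eq a (coeff f k) (coeff g k) _ _ ⟩
    (a ℤ.* coeff f k ℤ.+ coeff (0ℤ ∷ h ⊗ f) k) ℤ.+ (a ℤ.* coeff g k ℤ.+ coeff (0ℤ ∷ h ⊗ g) k)
      ≡⟨ sym (cong₂ ℤ._+_ (coeff-∷⊗ a h f k) (coeff-∷⊗ a h g k)) ⟩
    coeff ((a ∷ h) ⊗ f) k ℤ.+ coeff ((a ∷ h) ⊗ g) k ∎
    where
    open ≡-Reasoning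
    eq : ∀ a b c x y → a ℤ.* (b ℤ.+ c) ℤ.+ (x ℤ.+ y) ≡ (a ℤ.* b ℤ.+ x) ℤ.+ (a ℤ.* c ℤ.+ y)
    eq = solve-∀
    shift : ∀ k → coeff (0ℤ ∷ h ⊗ (f ⊕ g)) k ≡ coeff (0ℤ ∷ h ⊗ f) k ℤ.+ coeff (0ℤ ∷ h ⊗ g) k
    shift zero    = refl
    shift (suc k) = ⊗-distribˡ-⊕ h f g k

  ⊗-neg : ∀ f g k → coeff (f ⊗ map ℤ.-_ g) k ≡ ℤ.- coeff (f ⊗ g) k
  ⊗-neg []      g k = refl
  ⊗-neg (a ∷ f) g k = begin
    coeff ((a ∷ f) ⊗ map ℤ.-_ g) k
      ≡⟨ coeff-∷⊗ a f _ k ⟩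
    a ℤ.* coeff (map ℤ.-_ g) k ℤ.+ coeff (0ℤ ∷ f ⊗ map ℤ.-_ g) k
      ≡⟨ cong₂ (λ u v → a ℤ.* u ℤ.+ v) (coeff-neg g k) (shift k) ⟩
    a ℤ.* ℤ.- coeff g k ℤ.+ ℤ.- coeff (0ℤ ∷ f ⊗ g) k
      ≡⟨ eq a (coeff g k) _ ⟩
    ℤ.- (a ℤ.* coeff g k ℤ.+ coeff (0ℤ ∷ f ⊗ g) k)
      ≡⟨ cong ℤ.-_ (sym (coeff-∷⊗ a f g k)) ⟩
    ℤ.- coeff ((a ∷ f) ⊗ g) k ∎
    where
    open ≡-Reasoning
    eq : ∀ a b x → a ℤ.* ℤ.- b ℤ.+ ℤ.- x ≡ ℤ.- (a ℤ.* b ℤ.+ x)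
    eq = solve-∀
    shift : ∀ k → coeff (0ℤ ∷ f ⊗ map ℤ.-_ g) k ≡ ℤ.- coeff (0ℤ ∷ f ⊗ g) k
    shift zero    = refl
    shift (suc k) = ⊗-neg f g k

  ⊗-zeroʳ : ∀ f k → coeff (f ⊗ []) k ≡ 0ℤ
  ⊗-zeroʳ []      k       = refl
  ⊗-zeroʳ (a ∷ f) zero    = refl
  ⊗-zeroʳ (a ∷ f) (suc k) = ⊗-zeroʳ f k

  X^-⊗ : ∀ m n k → coeff (X^ m ⊗ X^ n) k ≡ coeff (X^ (m + n)) k
  X^-⊗ zero    n k = trans (coeff-∷⊗ 1ℤ [] (X^ n) k)
    (trans (cong₂ ℤ._+_ (ℤ.*-identityˡ (coeff (X^ n) k)) (0-coeff k)) (ℤ.+-identityʳ _))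
    where
    0-coeff : ∀ k → coeff (0ℤ ∷ []) k ≡ 0ℤ
    0-coeff zero    = refl
    0-coeff (suc k) = refl
  X^-⊗ (suc m) n k = trans (coeff-∷⊗ 0ℤ (X^ m) (X^ n) k)
    (trans (ℤ.+-identityˡ _) (∷-cong {X^ m ⊗ X^ n} {X^ (m + n)} (X^-⊗ m n) k))

  coeff-X^ : ∀ m k → coeff (X^ m) k ≡ + ⟦ m ℕ.≟ k ⟧
  coeff-X^ zero    zero    = refl
  coeff-X^ zero    (suc k) = refl
  coeff-X^ (suc m) zero    = refl
  coeff-X^ (suc m) (suc k) = trans (coeff-X^ m k)
    (cong +_ (⟦⟧-cong (cong suc) ℕ.suc-injective (m ℕ.≟ k) (suc m ℕ.≟ suc k)))

  module _ {a} {A : Set a} where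

    coeff-∑ : ∀ xs {f : A → Poly} {c k} → (∀ x → coeff (f x) k ≡ + c x) →
      coeff (∑ xs f) k ≡ + sum (map c xs)
    coeff-∑ []       eq = refl
    coeff-∑ (x ∷ xs) {f} {c} {k} eq =
      trans (coeff-⊕ (f x) _ k) (trans (cong₂ ℤ._+_ (eq x) (coeff-∑ xs eq)) (sym (ℤ.pos-+ (c x) _)))

    ⊗-∑ : ∀ h xs (f : A → Poly) k → coeff (h ⊗ ∑ xs f) k ≡ coeff (∑ xs (λ x → h ⊗ f x)) k
    ⊗-∑ h []       f k = ⊗-zeroʳ h k
    ⊗-∑ h (x ∷ xs) f k = trans (⊗-distribˡ-⊕ h (f x) _ k)
      (trans (cong (ℤ._+_ (coeff (h ⊗ f x) k)) (⊗-∑ h xs f k)) (sym (coeff-⊕ (h ⊗ f x) _ k)))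

    ∑-⊗ : ∀ h xs (f : A → Poly) k → coeff (∑ xs f ⊗ h) k ≡ coeff (∑ xs (λ x → f x ⊗ h)) k
    ∑-⊗ h []       f k = refl
    ∑-⊗ h (x ∷ xs) f k = trans (⊗-distribʳ-⊕ h (f x) _ k)
      (trans (cong (ℤ._+_ (coeff (f x ⊗ h) k)) (∑-⊗ h xs f k)) (sym (coeff-⊕ (f x ⊗ h) _ k)))

  module _ (n : ℕ) .{{_ : NonZero n}} where

    private
      M : Poly
      M = X^ n ⊖ X^ 0

    infix 4 _∼_
    -- Coefficients are compared as integers, so plain rewriting applies; the passage to congruence
    -- modulo l happens only in `∼⇒≈`.
    record _∼_ (f g : Poly) : Set where
      constructor _∙_
      field
        multiplier : Poly
        coeff-eq   : ∀ k → coeff f k ≡ coeff g k ℤ.+ coeff (multiplier ⊗ M) k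

    ∼-reflexive : ∀ {f g} → (∀ k → coeff f k ≡ coeff g k) → f ∼ g
    ∼-reflexive eq = [] ∙ λ k → trans (eq k) (sym (ℤ.+-identityʳ _))

    ∼-trans : ∀ {f g h} → f ∼ g → g ∼ h → f ∼ h
    ∼-trans {h = h} (u ∙ p) (v ∙ q) = (v ⊕ u) ∙ λ k → trans (p k) (trans (cong (ℤ._+ _) (q k))
      (trans (ℤ.+-assoc (coeff h k) _ _) (cong (ℤ._+_ (coeff h k)) (sym (⊗-distribʳ-⊕ M v u k)))))

    ∼-⊕ : ∀ {f f′ g g′} → f ∼ f′ → g ∼ g′ → f ⊕ g ∼ f′ ⊕ g′
    ∼-⊕ {f} {f′} {g} {g′} (u ∙ p) (v ∙ q) = (u ⊕ v) ∙ λ k → begin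
      coeff (f ⊕ g) k ≡⟨ coeff-⊕ f g k ⟩
      coeff f k ℤ.+ coeff g k ≡⟨ cong₂ ℤ._+_ (p k) (q k) ⟩
      (coeff f′ k ℤ.+ coeff (u ⊗ M) k) ℤ.+ (coeff g′ k ℤ.+ coeff (v ⊗ M) k) ≡⟨ eq (coeff f′ k) _ (coeff g′ k) _ ⟩
      (coeff f′ k ℤ.+ coeff g′ k) ℤ.+ (coeff (u ⊗ M) k ℤ.+ coeff (v ⊗ M) k)
        ≡⟨ sym (cong₂ ℤ._+_ (coeff-⊕ f′ g′ k) (⊗-distribʳ-⊕ M u v k)) ⟩
      coeff (f′ ⊕ g′) k ℤ.+ coeff ((u ⊕ v) ⊗ M) k ∎
      where
      open ≡-Reasoning
      eq : ∀ a b c d → (a ℤ.+ b) ℤ.+ (c ℤ.+ d) ≡ (a ℤ.+ c) ℤ.+ (b ℤ.+ d)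
      eq = solve-∀

    ∼-∑ : ∀ {a} {A : Set a} (xs : List A) {f g : A → Poly} → (∀ x → f x ∼ g x) → ∑ xs f ∼ ∑ xs g
    ∼-∑ []       eq = ∼-reflexive (λ _ → refl)
    ∼-∑ (x ∷ xs) eq = ∼-⊕ (eq x) (∼-∑ xs eq)

    -- The multiplier is x^r, since x^(n+r) - x^r = x^r (x^n - 1).
    X^[n+r]∼X^r : ∀ r → X^ (n + r) ∼ X^ r
    X^[n+r]∼X^r r = X^ r ∙ λ k → sym (begin
      coeff (X^ r) k ℤ.+ coeff (X^ r ⊗ M) k
        ≡⟨ cong (ℤ._+_ (coeff (X^ r) k)) (⊗-distribˡ-⊕ (X^ r) (X^ n) _ k) ⟩
      coeff (X^ r) k ℤ.+ (coeff (X^ r ⊗ X^ n) k ℤ.+ coeff (X^ r ⊗ map ℤ.-_ (X^ 0)) k)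
        ≡⟨ cong₂ (λ u v → coeff (X^ r) k ℤ.+ (u ℤ.+ v))
             (trans (X^-⊗ r n k) (cong (λ e → coeff (X^ e) k) (ℕ.+-comm r n)))
             (trans (⊗-neg (X^ r) (X^ 0) k)
               (cong ℤ.-_ (trans (X^-⊗ r 0 k) (cong (λ e → coeff (X^ e) k) (ℕ.+-identityʳ r))))) ⟩
      coeff (X^ r) k ℤ.+ (coeff (X^ (n + r)) k ℤ.- coeff (X^ r) k)
        ≡⟨ eq (coeff (X^ r) k) _ ⟩
      coeff (X^ (n + r)) k ∎)
      where
      open ≡-Reasoning
      eq : ∀ a b → a ℤ.+ (b ℤ.- a) ≡ b
      eq = solve-∀

    X^-∼-% : ∀ m → X^ m ∼ X^ (m % n)
    X^-∼-% m = subst (λ e → X^ e ∼ X^ (m % n))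
      (sym (trans (ℕ.m≡m%n+[m/n]*n m n) (ℕ.+-comm (m % n) _))) (multiple (m / n))
      where
      multiple : ∀ y → X^ (y * n + m % n) ∼ X^ (m % n)
      multiple zero    = ∼-reflexive (λ _ → refl)
      multiple (suc y) = subst (λ e → X^ e ∼ X^ (m % n)) (sym (ℕ.+-assoc n (y * n) (m % n)))
        (∼-trans (X^[n+r]∼X^r (y * n + m % n)) (multiple y))

    -- Reducing every exponent modulo n brings the product to degree below n, where coefficients can
    -- be compared one by one.
    ∑X^-⊗-∑X^ : ∀ {a b} {A : Set a} {B : Set b} (xs : List A) (ys : List B) (f : A → ℕ) (g : B → ℕ) →
      ∑ xs (X^ ∘ f) ⊗ ∑ ys (X^ ∘ g) ∼ ∑ xs (λ x → ∑ ys (λ y → X^ ((f x + g y) % n)))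
    ∑X^-⊗-∑X^ xs ys f g =
      ∼-trans (∼-reflexive (∑-⊗ (∑ ys (X^ ∘ g)) xs (X^ ∘ f)))
        (∼-∑ xs λ x → ∼-trans (∼-reflexive (⊗-∑ (X^ (f x)) ys (X^ ∘ g)))
          (∼-∑ ys λ y → ∼-trans (∼-reflexive (X^-⊗ (f x) (g y))) (X^-∼-% (f x + g y))))

    ∼⇒≈ : ∀ {f g} → f ∼ g → f ≈ g [mod⟨ M ⟩]
    ∼⇒≈ {f} {g} (u ∙ eq) = u , λ k → mod-reflexive (begin
      coeff (f ⊖ g) k ≡⟨ trans (coeff-⊕ f _ k) (cong (ℤ._+_ (coeff f k)) (coeff-neg g k)) ⟩
      coeff f k ℤ.- coeff g k ≡⟨ cong (ℤ._- coeff g k) (eq k) ⟩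
      coeff g k ℤ.+ coeff (u ⊗ M) k ℤ.- coeff g k ≡⟨ cancel (coeff g k) _ ⟩
      coeff (u ⊗ M) k ∎)
      where
      open ≡-Reasoning
      cancel : ∀ a b → a ℤ.+ b ℤ.- a ≡ b
      cancel = solve-∀

-- Orders and primitive roots

module Mod-Reasoning (m : ℕ) = SetoidReasoning (CommutativeRing.setoid (ℤ/ m))

mod-cancelˡ : ∀ {m c a b} → Unit m c → c ℤ.* a ≡ c ℤ.* b [mod m ] → a ≡ b [mod m ]
mod-cancelˡ {m} {c} {a} {b} (unit c′ p) q = begin
  a                  ≈⟨ expand a ⟨
  c′ ℤ.* (c ℤ.* a)   ≈⟨ mod-*-congˡ c′ q ⟩
  c′ ℤ.* (c ℤ.* b)   ≈⟨ expand b ⟩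
  b                  ∎
  where
  open Mod-Reasoning m
  eq : ∀ c c′ a → c′ ℤ.* (c ℤ.* a) ≡ c ℤ.* c′ ℤ.* a
  eq = solve-∀
  expand : ∀ a → c′ ℤ.* (c ℤ.* a) ≡ a [mod m ]
  expand a = mod-trans (mod-reflexive (eq c c′ a))
    (mod-trans (mod-*-congʳ a p) (mod-reflexive (ℤ.*-identityˡ a)))

-- With a - b = k m divisible by n, multiplying by the inverse of m modulo n shows that n divides k.
mod-combine : ∀ {m n a b} → Unit n (+ m) → a ≡ b [mod m ] → a ≡ b [mod n ] → a ≡ b [mod m * n ]
mod-combine {m} {n} {a} {b} (unit c (congruent n∣mc-1)) (congruent (ℤᵈ.divides k a-b≡km)) (congruent n∣a-b) =
  congruent (subst (_∣ᶻ a ℤ.- b) (sym (ℤ.pos-* m n))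
    (subst₂ _∣ᶻ_ refl (trans (ℤ.*-comm (+ m) k) (sym a-b≡km)) (ℤᵈ.*-monoʳ-∣ (+ m) n∣k)))
  where
  eq : ∀ k m c → c ℤ.* (k ℤ.* m) ℤ.+ ℤ.- k ℤ.* (m ℤ.* c ℤ.- 1ℤ) ≡ k
  eq = solve-∀
  n∣k : + n ∣ᶻ k
  n∣k = subst (+ n ∣ᶻ_) (eq k (+ m) c) (∣-comb c (ℤ.- k) (subst (+ n ∣ᶻ_) a-b≡km n∣a-b) n∣mc-1)

mod-CRT : ∀ {m n} .{{_ : NonZero m}} .{{_ : NonZero n}} → Unit n (+ m) → ∀ a b →
  ∃ λ r → + r ≡ a [mod m ] × + r ≡ b [mod n ]
mod-CRT {m} {n} (unit c (congruent n∣mc-1)) a b =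
  x %ℕ (m * n) , mod-trans (mod-∣ (ℕᵈ.m∣m*n n) (mod-sym (mod-% (m * n) x))) x≡a
               , mod-trans (mod-∣ (ℕᵈ.n∣m*n m) (mod-sym (mod-% (m * n) x))) x≡b
  where
  instance _ = ℕ.m*n≢0 m n
  -- Start at a and add a multiple of m; since m c ≡ 1 modulo n, the correction is b - a modulo n.
  x = a ℤ.+ + m ℤ.* (c ℤ.* (b ℤ.- a))
  x≡a : x ≡ a [mod m ]
  x≡a = mod-+multiple a _
  eq : ∀ a b m c → (b ℤ.- a) ℤ.* (m ℤ.* c ℤ.- 1ℤ) ≡ a ℤ.+ m ℤ.* (c ℤ.* (b ℤ.- a)) ℤ.- b
  eq = solve-∀
  x≡b : x ≡ b [mod n ]
  x≡b = congruent (subst (+ n ∣ᶻ_) (eq a b (+ m) c) (ℤᵈ.∣n⇒∣m*n (b ℤ.- a) n∣mc-1))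

Unit-*ˡ : ∀ {m} a {b} → Unit m (a ℤ.* b) → Unit m a
Unit-*ˡ a {b} (unit c p) = unit (b ℤ.* c) (mod-trans (mod-reflexive (sym (ℤ.*-assoc a b c))) p)

Unit-root : ∀ {m a} k → 1 ≤ k → a ℤ.^ k ≡ 1ℤ [mod m ] → Unit m a
Unit-root {a = a} (suc k) _ a^k≡1 = unit (a ℤ.^ k) a^k≡1

module _ {m x d} (ord : HasOrder m x d) where
  open HasOrder ord

  private instance
    d≢0 : NonZero d
    d≢0 = >-nonZero positive

  order-Unit : Unit m x
  order-Unit = Unit-root d positive power≡1

  order-multiple : ∀ k → x ℤ.^ (k * d) ≡ 1ℤ [mod m ]
  order-multiple k = begin
    x ℤ.^ (k * d)     ≡⟨ cong (x ℤ.^_) (ℕ.*-comm k d) ⟩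
    x ℤ.^ (d * k)     ≡⟨ ℤ.^-*-assoc x d k ⟨
    (x ℤ.^ d) ℤ.^ k   ≈⟨ mod-^-cong k power≡1 ⟩
    1ℤ ℤ.^ k          ≡⟨ ℤ.^-zeroˡ k ⟩
    1ℤ ∎
    where open Mod-Reasoning m

  order-% : ∀ k → x ℤ.^ k ≡ x ℤ.^ (k % d) [mod m ]
  order-% k = begin
    x ℤ.^ k                                ≡⟨ cong (x ℤ.^_) (ℕ.m≡m%n+[m/n]*n k d) ⟩
    x ℤ.^ (k % d + k / d * d)              ≡⟨ ℤ.^-distribˡ-+-* x (k % d) _ ⟩
    x ℤ.^ (k % d) ℤ.* x ℤ.^ (k / d * d)    ≈⟨ mod-*-congˡ (x ℤ.^ (k % d)) (order-multiple (k / d)) ⟩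
    x ℤ.^ (k % d) ℤ.* 1ℤ                   ≡⟨ ℤ.*-identityʳ _ ⟩
    x ℤ.^ (k % d)                          ∎
    where open Mod-Reasoning m

  order-cong : ∀ {a b} → + a ≡ + b [mod d ] → x ℤ.^ a ≡ x ℤ.^ b [mod m ]
  order-cong {a} {b} a≡b = mod-trans (order-% a)
    (mod-trans (mod-reflexive (cong (x ℤ.^_) a%≡b%)) (mod-sym (order-% b)))
    where
    a%≡b% : a % d ≡ b % d
    a%≡b% = mod⇒≡ (ℕ.m%n<n a d) (ℕ.m%n<n b d)
      (mod-trans (mod-sym (mod-% d (+ a))) (mod-trans a≡b (mod-% d (+ b))))

  order-∣ : ∀ k → x ℤ.^ k ≡ 1ℤ [mod m ] → d ∣ k
  order-∣ k x^k≡1 = ℕᵈ.m%n≡0⇒n∣m k d (remainder (k % d) (ℕ.m%n<n k d)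
    (mod-trans (mod-sym (order-% k)) x^k≡1))
    where
    remainder : ∀ r → r < d → x ℤ.^ r ≡ 1ℤ [mod m ] → r ≡ 0
    remainder zero    _   _     = refl
    remainder (suc r) r<d x^r≡1 = contradiction (minimal (suc r) (s≤s z≤n) x^r≡1) (ℕ.<⇒≱ r<d)

  -- Cancelling x^a would give x^(b-a) ≡ 1 with 0 < b - a < d, against minimality of d.
  order-injective : ∀ {a b} → a < b → b < d → ¬ x ℤ.^ a ≡ x ℤ.^ b [mod m ]
  order-injective {a} {b} a<b b<d x^a≡x^b = contradiction
    (minimal (b ∸ a) (ℕ.m<n⇒0<n∸m a<b) (mod-sym (mod-cancelˡ (Unit-^ a order-Unit) (begin
      x ℤ.^ a ℤ.* 1ℤ              ≡⟨ ℤ.*-identityʳ _ ⟩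
      x ℤ.^ a                     ≈⟨ x^a≡x^b ⟩
      x ℤ.^ b                     ≡⟨ cong (x ℤ.^_) (ℕ.m+[n∸m]≡n (ℕ.<⇒≤ a<b)) ⟨
      x ℤ.^ (a + (b ∸ a))         ≡⟨ ℤ.^-distribˡ-+-* x a (b ∸ a) ⟩
      x ℤ.^ a ℤ.* x ℤ.^ (b ∸ a)   ∎))))
    (ℕ.<⇒≱ (ℕ.≤-<-trans (ℕ.m∸n≤m b a) b<d))
    where open Mod-Reasoning m

  -- The powers x^0, …, x^(d-1) are d distinct values, so d candidates covering
  -- all powers of x are themselves powers of x.
  powers-exhaust : (e : Fin d → ℤ) → (∀ r → ∃ λ k → x ℤ.^ r ≡ e k [mod m ]) →
    ∀ k → ∃ λ r → e k ≡ x ℤ.^ r [mod m ]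
  -- There are d + 1 items for d places: k itself and the places of x^0, ..., x^(d-1). Two powers
  -- cannot collide, so one of them collides with k.
  powers-exhaust e covers k with Fin.pigeonhole (ℕ.n<1+n d) place
    where
    place : Fin (suc d) → Fin d
    place zero    = k
    place (suc i) = proj₁ (covers (toℕ i))
  ... | zero  , suc j , _         , k≡j = toℕ j ,
    mod-trans (mod-reflexive (cong e k≡j)) (mod-sym (proj₂ (covers (toℕ j))))
  ... | suc i , suc j , s≤s i<j , i≡j = contradiction
    (mod-trans (proj₂ (covers (toℕ i))) (mod-trans (mod-reflexive (cong e i≡j)) (mod-sym (proj₂ (covers (toℕ j))))))
    (order-injective i<j (Fin.toℕ<n j))

  -- As x^(a d) ≡ 1, the inverse of x^a is x^(a (d-1)); this keeps the exponent of the quotient x^b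
  -- / x^a a natural number.
  quotient-of-powers : ∀ a b {c u} → c ≡ x ℤ.^ a [mod m ] → u ≡ x ℤ.^ b [mod m ] →
    u ≡ c ℤ.* x ℤ.^ (b + a * pred d) [mod m ]
  quotient-of-powers a b {c} {u} c≡x^a u≡x^b = begin
    u                                    ≈⟨ u≡x^b ⟩
    x ℤ.^ b                              ≡⟨ ℤ.*-identityʳ _ ⟨
    x ℤ.^ b ℤ.* 1ℤ                       ≈⟨ mod-*-congˡ (x ℤ.^ b) (order-multiple a) ⟨
    x ℤ.^ b ℤ.* x ℤ.^ (a * d)            ≡⟨ cong (λ e → x ℤ.^ b ℤ.* x ℤ.^ (a * e)) (ℕ.suc-pred d) ⟨
    x ℤ.^ b ℤ.* x ℤ.^ (a * suc (pred d)) ≡⟨ cong (λ e → x ℤ.^ b ℤ.* x ℤ.^ e) (ℕ.*-suc a (pred d)) ⟩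
    x ℤ.^ b ℤ.* x ℤ.^ (a + a * pred d)   ≡⟨ cong (x ℤ.^ b ℤ.*_) (ℤ.^-distribˡ-+-* x a _) ⟩
    x ℤ.^ b ℤ.* (x ℤ.^ a ℤ.* x ℤ.^ (a * pred d)) ≡⟨ rearrange (x ℤ.^ b) (x ℤ.^ a) _ ⟩
    x ℤ.^ a ℤ.* (x ℤ.^ b ℤ.* x ℤ.^ (a * pred d)) ≡⟨ cong (x ℤ.^ a ℤ.*_) (ℤ.^-distribˡ-+-* x b _) ⟨
    x ℤ.^ a ℤ.* x ℤ.^ (b + a * pred d)           ≈⟨ mod-*-congʳ _ c≡x^a ⟨
    c ℤ.* x ℤ.^ (b + a * pred d)                 ∎
    where
    open Mod-Reasoning m
    rearrange : ∀ a b c → a ℤ.* (b ℤ.* c) ≡ b ℤ.* (a ℤ.* c)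
    rearrange = solve-∀

module _ {m g} .{{_ : NonZero m}} (root : PrimitiveRoot m g) where

  private
    units : List ℕ
    units = filter (λ k → coprime? k m) (applyUpTo suc m)

    unit-index : ∀ {u} → Unit m u → ∃ λ k → u ≡ + lookup units k [mod m ]
    unit-index {u} isUnit = index r∈units ,
      mod-trans u≡r (mod-reflexive (cong +_ (lookup-index r∈units)))
      where
      -- `φ` counts the representatives 1, ..., m rather than 0, ..., m-1, hence the shift by one.
      r = (u ℤ.- 1ℤ) %ℕ m
      eq : ∀ u → 1ℤ ℤ.+ (u ℤ.- 1ℤ) ≡ u
      eq = solve-∀
      u≡r : u ≡ + suc r [mod m ]
      u≡r = mod-trans (mod-reflexive (sym (eq u))) (mod-+-cong (mod-refl {a = 1ℤ}) (mod-% m (u ℤ.- 1ℤ)))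
      r∈units : suc r ∈ units
      r∈units = ∈-filter⁺ (λ k → coprime? k m) (∈-applyUpTo⁺ suc (n%ℕd<d (u ℤ.- 1ℤ) m))
                          (Unit⇒Coprime (Unit-resp u≡r isUnit))

  abstract
    -- By definition `units` has exactly φ m entries, the order of g, so `powers-exhaust` applies
    -- with these entries as the candidates.
    primitiveRoot-generates : ∀ {u} → Unit m u → ∃ λ k → u ≡ g ℤ.^ k [mod m ]
    primitiveRoot-generates isUnit =
      let k , u≡k = unit-index isUnit
          r , k≡r = powers-exhaust root (λ k → + lookup units k) (λ r → unit-index (Unit-^ r (order-Unit root))) k
      in r , mod-trans u≡k k≡r

module _ {m g l h} (ord-g : HasOrder m g (h * 2)) (ord-l : HasOrder m l h)
         e (l≡g^e : l ≡ g ℤ.^ e [mod m ]) where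

  -- From g^(h e) ≡ l^h ≡ 1 the order 2h of g divides h e, so 2 divides e.
  half-order-even : 2 ∣ e
  half-order-even = ℕᵈ.*-cancelˡ-∣ h (order-∣ ord-g (h * e) (begin
    g ℤ.^ (h * e)     ≡⟨ cong (g ℤ.^_) (ℕ.*-comm h e) ⟩
    g ℤ.^ (e * h)     ≡⟨ ℤ.^-*-assoc g e h ⟨
    (g ℤ.^ e) ℤ.^ h   ≈⟨ mod-^-cong h l≡g^e ⟨
    l ℤ.^ h           ≈⟨ HasOrder.power≡1 ord-l ⟩
    1ℤ                ∎))
    where
    open Mod-Reasoning m
    instance _ = >-nonZero (HasOrder.positive ord-l)

  -- Powers of l lie among the h candidates g^(2i), i < h, because e is even. As l has order h, the
  -- candidates are exhausted.
  half-order-generates-squares : ∀ k → ∃ λ r → g ℤ.^ (k * 2) ≡ l ℤ.^ r [mod m ]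
  half-order-generates-squares k =
    let r , p = powers-exhaust ord-l (λ i → g ℤ.^ (toℕ i * 2)) covers (fromℕ< (ℕ.m%n<n k h))
    in r , mod-trans (reduce k) p
    where
    open Mod-Reasoning m
    instance
      _ = >-nonZero (HasOrder.positive ord-l)
      _ = >-nonZero (HasOrder.positive ord-g)
    f = ℕᵈ.quotient half-order-even
    e≡f*2 : e ≡ f * 2
    e≡f*2 = ℕᵈ._∣_.equality half-order-even
    reduce : ∀ k → g ℤ.^ (k * 2) ≡ g ℤ.^ (toℕ (fromℕ< (ℕ.m%n<n k h)) * 2) [mod m ]
    reduce k = mod-trans (order-% ord-g (k * 2)) (mod-reflexive (cong (g ℤ.^_)
      (trans (sym (ℕ.m%n*o≡m*o%[n*o] k h 2)) (cong (_* 2) (sym (Fin.toℕ-fromℕ< (ℕ.m%n<n k h)))))))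
    covers : ∀ r → ∃ λ i → l ℤ.^ r ≡ g ℤ.^ (toℕ i * 2) [mod m ]
    covers r = fromℕ< (ℕ.m%n<n (f * r) h) , (begin
      l ℤ.^ r               ≈⟨ mod-^-cong r l≡g^e ⟩
      (g ℤ.^ e) ℤ.^ r       ≡⟨ ℤ.^-*-assoc g e r ⟩
      g ℤ.^ (e * r)         ≡⟨ cong (λ z → g ℤ.^ (z * r)) e≡f*2 ⟩
      g ℤ.^ (f * 2 * r)     ≡⟨ cong (g ℤ.^_) (trans (ℕ.*-assoc f 2 r) (trans (cong (f *_) (ℕ.*-comm 2 r)) (sym (ℕ.*-assoc f r 2)))) ⟩
      g ℤ.^ (f * r * 2)     ≈⟨ reduce (f * r) ⟩
      g ℤ.^ (toℕ (fromℕ< (ℕ.m%n<n (f * r) h)) * 2) ∎)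

-- Prime powers and quadratic characters

-- The sum 1 + x + ... + x^(n-1) in Horner form.
geometric : ℕ → ℤ → ℤ
geometric zero    x = 0ℤ
geometric (suc n) x = 1ℤ ℤ.+ x ℤ.* geometric n x

geometric-telescope : ∀ n x → (x ℤ.- 1ℤ) ℤ.* geometric n x ≡ x ℤ.^ n ℤ.- 1ℤ
geometric-telescope zero    x = ℤ.*-zeroʳ (x ℤ.- 1ℤ)
geometric-telescope (suc n) x =
  trans (expand x (geometric n x)) (trans (cong (λ z → x ℤ.- 1ℤ ℤ.+ x ℤ.* z) (geometric-telescope n x)) (collect x (x ℤ.^ n)))
  where
  expand : ∀ x g → (x ℤ.- 1ℤ) ℤ.* (1ℤ ℤ.+ x ℤ.* g) ≡ x ℤ.- 1ℤ ℤ.+ x ℤ.* ((x ℤ.- 1ℤ) ℤ.* g)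
  expand = solve-∀
  collect : ∀ x y → x ℤ.- 1ℤ ℤ.+ x ℤ.* (y ℤ.- 1ℤ) ≡ x ℤ.* y ℤ.- 1ℤ
  collect = solve-∀

geometric-mod : ∀ {m x} n → x ≡ 1ℤ [mod m ] → geometric n x ≡ + n [mod m ]
geometric-mod zero    x≡1 = mod-refl
geometric-mod {x = x} (suc n) x≡1 = mod-+-cong (mod-refl {a = 1ℤ})
  (mod-trans (mod-*-cong x≡1 (geometric-mod n x≡1)) (mod-reflexive (ℤ.*-identityˡ (+ n))))

-- Factor x^p - 1 = (x - 1)(1 + x + ... + x^(p-1)). The second factor is ≡ p modulo m, hence
-- divisible by p since p divides m.
^-lift-mod : ∀ {p m x} → p ∣ m → x ≡ 1ℤ [mod m ] → x ℤ.^ p ≡ 1ℤ [mod p * m ]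
^-lift-mod {p} {m} {x} p∣m x≡1 = congruent (subst₂ _∣ᶻ_
  (trans (sym (ℤ.pos-* m p)) (cong +_ (ℕ.*-comm m p))) (geometric-telescope p x)
  (ℤᵈ.∣-trans (ℤᵈ.*-monoˡ-∣ (+ p) (modulus∣difference x≡1)) (ℤᵈ.*-monoʳ-∣ (x ℤ.- 1ℤ) p∣G)))
  where
  p∣G : + p ∣ᶻ geometric p x
  p∣G = ∣-resp-mod p∣m (mod-sym (geometric-mod p x≡1)) ℤᵈ.∣-refl

-- The power p^k annihilates the kernel of reduction from units modulo p^(k+1) to units modulo p.
-- This carries inverses and exponent parities between the two moduli.
^-lift-mod-^ : ∀ {p x} k → x ≡ 1ℤ [mod p ] → x ℤ.^ (p ^ k) ≡ 1ℤ [mod p ^ suc k ]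
^-lift-mod-^ {p} {x} zero    x≡1 =
  subst₂ (λ y m → y ≡ 1ℤ [mod m ]) (sym (ℤ.^-identityʳ x)) (sym (ℕ.^-identityʳ p)) x≡1
^-lift-mod-^ {p} {x} (suc k) x≡1 = subst (_≡ 1ℤ [mod p ^ suc (suc k) ])
  (trans (ℤ.^-*-assoc x (p ^ k) p) (cong (x ℤ.^_) (ℕ.*-comm (p ^ k) p)))
  (^-lift-mod {p} (ℕᵈ.m∣m*n (p ^ k)) (^-lift-mod-^ k x≡1))

-- If a c ≡ 1 modulo p, then (a c)^(p^k) ≡ 1 modulo p^(k+1), so a c and with it the factor a is
-- invertible there.
Unit-mod-^ : ∀ {p a} k .{{_ : NonZero p}} → Unit p a → Unit (p ^ suc k) a
Unit-mod-^ {p} {a} k (unit c ac≡1) = Unit-*ˡ a {c} (Unit-root (p ^ k) (ℕ.m^n>0 p k) (^-lift-mod-^ k ac≡1))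

parity-even : ∀ {n} → 2 ∣ n → parity n ≡ 0ℙ
parity-even (ℕᵈ.divides k refl) = trans (ℙ.*-homo-* k 2) (ℙ.*-zeroʳ (parity k))

even-parity : ∀ n → parity n ≡ 0ℙ → 2 ∣ n
even-parity zero          _  = 2 ℕᵈ.∣0
even-parity (suc (suc n)) eq = ℕᵈ.∣m∣n⇒∣m+n ℕᵈ.∣-refl (even-parity n eq)

parity-odd : ∀ {n} → ¬ 2 ∣ n → parity n ≡ 1ℙ
parity-odd {n} 2∤n with parity n in eq
... | 0ℙ = contradiction (even-parity n eq) 2∤n
... | 1ℙ = refl

parity-^-odd : ∀ {n} k → parity n ≡ 1ℙ → parity (n ^ k) ≡ 1ℙ
parity-^-odd     zero    eq = refl
parity-^-odd {n} (suc k) eq = trans (ℙ.*-homo-* n (n ^ k)) (cong₂ ℙ._*_ eq (parity-^-odd k eq))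

parity-pred : ∀ n .{{_ : NonZero n}} → parity (pred n) ≡ parity n ℙ.⁻¹
parity-pred (suc n) = sym (ℙ.suc-homo-⁻¹ n)

-- For even n the factor n - 1 is odd, so the exponent a + b (n-1), which stands for a - b, has the
-- parity of a + b.
parity-+-even : ∀ a b n .{{_ : NonZero n}} → 2 ∣ n → parity (a + b * pred n) ≡ parity a ℙ.+ parity b
parity-+-even a b n 2∣n = trans (ℙ.+-homo-+ a _) (cong (ℙ._+_ (parity a)) (trans (ℙ.*-homo-* b (pred n))
  (trans (cong (ℙ._*_ (parity b)) (trans (parity-pred n) (cong ℙ._⁻¹ (parity-even 2∣n)))) (ℙ.*-identityʳ (parity b)))))

parity-sum-zero : ∀ π ρ → π ℙ.+ ρ ≡ 0ℙ → π ≡ ρ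
parity-sum-zero 0ℙ 0ℙ _ = refl
parity-sum-zero 1ℙ 1ℙ _ = refl

multiple? : ∀ p x → Dec (+ p ∣ᶻ x)
multiple? p x = + p ∣ᶻ? x

nonmultiple-periodic : ∀ p → Periodic p (λ x → ⟦ ¬? (multiple? p x) ⟧)
nonmultiple-periodic p {a} {b} a≡b = ⟦⟧-cong (λ p∤a → p∤a ∘ ∣-resp-mod ℕᵈ.∣-refl (mod-sym a≡b))
                                             (λ p∤b → p∤b ∘ ∣-resp-mod ℕᵈ.∣-refl a≡b) _ _

S-multiples : ∀ n .{{_ : NonZero n}} {c} → Unit n c → ∀ x → S n (λ y → ⟦ multiple? n (x ℤ.+ c ℤ.* + y) ⟧) ≡ 1
S-multiples n {c} u x = trans (S-cong n λ y → ⟦⟧-cong to from _ (mod? n 0ℤ (x ℤ.+ c ℤ.* + y))) (S-solutions n u 0ℤ x)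
  where
  eq : ∀ z → ℤ.- z ≡ 0ℤ ℤ.- z
  eq = solve-∀
  neg : ∀ z → ℤ.- (0ℤ ℤ.- z) ≡ z
  neg = solve-∀
  to : ∀ {z} → + n ∣ᶻ z → 0ℤ ≡ z [mod n ]
  to {z} d = congruent (subst (+ n ∣ᶻ_) (eq z) (ℤᵈ.∣m⇒∣-m d))
  from : ∀ {z} → 0ℤ ≡ z [mod n ] → + n ∣ᶻ z
  from {z} (congruent d) = subst (+ n ∣ᶻ_) (neg z) (ℤᵈ.∣m⇒∣-m d)

Unit-1 : ∀ {n} → Unit n 1ℤ
Unit-1 = unit 1ℤ mod-refl

affine-1 : ∀ y → 0ℤ ℤ.+ 1ℤ ℤ.* y ≡ y
affine-1 = solve-∀

S-multiples-0 : ∀ n .{{_ : NonZero n}} → S n (λ y → ⟦ multiple? n (+ y) ⟧) ≡ 1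
S-multiples-0 n = trans (S-cong n λ y → cong (λ z → ⟦ multiple? n z ⟧) (sym (affine-1 (+ y)))) (S-multiples n Unit-1 0ℤ)

S-nonmultiples : ∀ n .{{_ : NonZero n}} → S n (λ y → ⟦ ¬? (multiple? n (+ y)) ⟧) ≡ n ∸ 1
S-nonmultiples n = begin
  S n (λ y → ⟦ ¬? (multiple? n (+ y)) ⟧)
    ≡⟨ ℕ.m+n∸m≡n (S n (λ y → ⟦ multiple? n (+ y) ⟧)) _ ⟨
  S n (λ y → ⟦ multiple? n (+ y) ⟧) + S n (λ y → ⟦ ¬? (multiple? n (+ y)) ⟧) ∸ S n (λ y → ⟦ multiple? n (+ y) ⟧)
    ≡⟨ cong₂ _∸_ (trans (sym (S-+ n _ _)) (S-cong n λ y → ⟦⟧-¬ (multiple? n (+ y)))) (S-multiples-0 n) ⟩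
  S n (λ _ → 1) ∸ 1
    ≡⟨ cong (_∸ 1) (trans (S-const n 1) (ℕ.*-identityʳ n)) ⟩
  n ∸ 1 ∎
  where open ≡-Reasoning

φ≡S : ∀ n → φ n ≡ S n (λ k → ⟦ coprime? (suc k) n ⟧)
φ≡S n = begin
  length (filter (λ k → coprime? k n) (applyUpTo suc n))
    ≡⟨ length≡sum (filter (λ k → coprime? k n) (applyUpTo suc n)) ⟩
  sum (map (λ _ → 1) (filter (λ k → coprime? k n) (applyUpTo suc n)))
    ≡⟨ sum-map-filter (λ k → coprime? k n) (λ _ → 1) (applyUpTo suc n) ⟩
  sum (map (λ k → ⟦ coprime? k n ⟧ * 1) (applyUpTo suc n))
    ≡⟨ cong sum (List.map-applyUpTo suc (λ k → ⟦ coprime? k n ⟧ * 1) n) ⟩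
  S n (λ k → ⟦ coprime? (suc k) n ⟧ * 1)
    ≡⟨ S-cong n (λ k → ℕ.*-identityʳ _) ⟩
  S n (λ k → ⟦ coprime? (suc k) n ⟧) ∎
  where open ≡-Reasoning

module _ {p} (prime : Prime p) where

  private instance
    p≢0 : NonZero p
    p≢0 = prime⇒nonZero prime

  prime≢1 : p ≢ 1
  prime≢1 = nonTrivial⇒≢1 {{prime⇒nonTrivial prime}}

  ∤⇒Unit : ∀ {x} → ¬ + p ∣ᶻ x → Unit p x
  ∤⇒Unit {x} p∤x = Unit-resp (mod-sym (mod-% p x)) (residue (x %ℕ p) (n%ℕd<d x p)
    λ p∣r → p∤x (∣-resp-mod ℕᵈ.∣-refl (mod-sym (mod-% p x)) p∣r))
    where
    residue : ∀ r → r < p → ¬ + p ∣ᶻ + r → Unit p (+ r)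
    residue zero    _   p∤r = contradiction (ℤᵈ.divides 0ℤ refl) p∤r
    residue (suc r) r<p p∤r = Coprime⇒Unit (Coprime.sym (prime⇒coprime prime r<p))

  ∤⇒Unit-^ : ∀ k {x} → ¬ + p ∣ᶻ x → Unit (p ^ suc k) x
  ∤⇒Unit-^ k = Unit-mod-^ k ∘ ∤⇒Unit

  φ-prime-power : ∀ k → φ (p ^ suc k) ≡ p ^ k * (p ∸ 1)
  φ-prime-power k = begin
    φ (p ^ suc k)
      ≡⟨ φ≡S (p ^ suc k) ⟩
    S (p ^ suc k) (λ y → ⟦ coprime? (suc y) (p ^ suc k) ⟧)
      ≡⟨ S-cong (p ^ suc k) (λ y → ⟦⟧-cong (Unit⇒∤ prime≢1 (ℕᵈ.m∣m*n (p ^ k)) ∘ Coprime⇒Unit)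
                                           (Unit⇒Coprime ∘ ∤⇒Unit-^ k) _ (¬? (multiple? p (+ suc y)))) ⟩
    S (p ^ suc k) (λ y → ⟦ ¬? (multiple? p (+ suc y)) ⟧)
      ≡⟨ S-cong (p ^ suc k) (λ y → cong (λ z → ⟦ ¬? (multiple? p z) ⟧) (eq (+ y))) ⟩
    S (p ^ suc k) (λ y → ⟦ ¬? (multiple? p (1ℤ ℤ.+ 1ℤ ℤ.* + y)) ⟧)
      -- The window 1, ..., p^(k+1) used by `φ` is shifted to 0, ..., p^(k+1) - 1 by periodicity.
      ≡⟨ S-affine (p ^ suc k) (Periodic-∣ (ℕᵈ.m∣m*n (p ^ k)) (nonmultiple-periodic p)) Unit-1 1ℤ ⟩
    S (p ^ suc k) (λ y → ⟦ ¬? (multiple? p (+ y)) ⟧)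
      ≡⟨ cong (λ n → S n (λ y → ⟦ ¬? (multiple? p (+ y)) ⟧)) (ℕ.*-comm p (p ^ k)) ⟩
    S (p ^ k * p) (λ y → ⟦ ¬? (multiple? p (+ y)) ⟧)
      ≡⟨ S-periods (p ^ k) p (nonmultiple-periodic p) ⟩
    p ^ k * S p (λ y → ⟦ ¬? (multiple? p (+ y)) ⟧)
      ≡⟨ cong (p ^ k *_) (S-nonmultiples p) ⟩
    p ^ k * (p ∸ 1) ∎
    where
    open ≡-Reasoning
    instance _ = ℕ.m^n≢0 p (suc k)
    eq : ∀ y → 1ℤ ℤ.+ y ≡ 1ℤ ℤ.+ 1ℤ ℤ.* y
    eq = solve-∀

module QuadraticClasses {p} (prime-p : Prime p) (2∤p : ¬ 2 ∣ p) {g} s′ (root : PrimitiveRoot (p ^ suc s′) g) where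

  private
    d = φ (p ^ suc s′)
    p∣p^s : p ∣ p ^ suc s′
    p∣p^s = ℕᵈ.m∣m*n (p ^ s′)
    instance
      p≢0 : NonZero p
      p≢0 = prime⇒nonZero prime-p
      p^s≢0 : NonZero (p ^ suc s′)
      p^s≢0 = ℕ.m^n≢0 p (suc s′)
      d≢0 : NonZero d
      d≢0 = >-nonZero (HasOrder.positive root)

    even-p∸1 : 2 ∣ p ∸ 1
    even-p∸1 = even-parity (p ∸ 1) (trans (parity-pred p) (cong ℙ._⁻¹ (parity-odd 2∤p)))

  half : ℕ
  half = ℕᵈ.quotient even-p∸1

  half*2 : p ∸ 1 ≡ half * 2
  half*2 = ℕᵈ._∣_.equality even-p∸1

  φ≡half : ∀ k → φ (p ^ suc k) ≡ p ^ k * half * 2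
  φ≡half k = trans (φ-prime-power prime-p k) (trans (cong (p ^ k *_) half*2) (sym (ℕ.*-assoc (p ^ k) half 2)))

  φ/2 : ∀ k → φ (p ^ suc k) / 2 ≡ p ^ k * half
  φ/2 k = trans (cong (_/ 2) (φ≡half k)) (ℕ.m*n/n≡m (p ^ k * half) 2)

  -- 0ℙ: squares mod p, 1ℙ: non-squares; both exclude multiples of p.
  record Class (π : Parity) (x : ℤ) : Set where
    constructor class
    field
      exponent : ℕ
      power    : x ≡ g ℤ.^ exponent [mod p ]
      parity≡  : parity exponent ≡ π

  Class-resp : ∀ {π x y} → x ≡ y [mod p ] → Class π x → Class π y
  Class-resp x≡y (class k x≡g^k eq) = class k (mod-trans (mod-sym x≡y) x≡g^k) eq

  Class-* : ∀ {π ρ x y} → Class π x → Class ρ y → Class (π ℙ.+ ρ) (x ℤ.* y)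
  Class-* (class j x≡g^j refl) (class k y≡g^k refl) = class (j + k)
    (mod-trans (mod-*-cong x≡g^j y≡g^k) (mod-reflexive (sym (ℤ.^-distribˡ-+-* g j k)))) (ℙ.+-homo-+ j k)

  Class-g : Class 1ℙ g
  Class-g = class 1 (mod-reflexive (sym (ℤ.^-identityʳ g))) refl

  Class-1 : Class 0ℙ 1ℤ
  Class-1 = class 0 mod-refl refl

  Class-^ : ∀ {π x} k → Class π x → Class (π ℙ.* parity k) (x ℤ.^ k)
  Class-^ {x = x} k (class j x≡g^j refl) = class (j * k)
    (mod-trans (mod-^-cong k x≡g^j) (mod-reflexive (ℤ.^-*-assoc g j k))) (ℙ.*-homo-* j k)

  Class⇒∤ : ∀ {π x} → Class π x → ¬ + p ∣ᶻ x
  Class⇒∤ (class k x≡g^k _) p∣x = Unit⇒∤ (prime≢1 prime-p) p∣p^s (Unit-^ k (order-Unit root))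
    (∣-resp-mod ℕᵈ.∣-refl x≡g^k p∣x)

  -- The exponent is found modulo p^s, where g is a primitive root, and the congruence is then
  -- reduced modulo p.
  ∤⇒Class : ∀ {x} → ¬ + p ∣ᶻ x → ∃ λ π → Class π x
  ∤⇒Class p∤x = let k , x≡g^k = primitiveRoot-generates root (∤⇒Unit-^ prime-p s′ p∤x)
                in parity k , class k (mod-∣ p∣p^s x≡g^k) refl

  -- If g^a ≡ g^b mod p, the p^s′-th power of g^(a+b(d-1)) ≡ 1 is trivial mod p^(s′+1),
  -- so the even number d divides p^s′(a+b(d-1)).
  Class-unique : ∀ {π ρ x} → Class π x → Class ρ x → π ≡ ρ
  Class-unique (class a x≡g^a refl) (class b x≡g^b refl) = parity-sum-zero (parity a) (parity b) (begin
    parity a ℙ.+ parity b       ≡⟨ parity-+-even a b d even-d ⟨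
    parity c                    ≡⟨ ℙ.*-identityʳ (parity c) ⟨
    parity c ℙ.* 1ℙ             ≡⟨ cong (ℙ._*_ (parity c)) (parity-^-odd s′ (parity-odd 2∤p)) ⟨
    parity c ℙ.* parity (p ^ s′) ≡⟨ ℙ.*-homo-* c (p ^ s′) ⟨
    parity (c * p ^ s′)         ≡⟨ parity-even (ℕᵈ.∣-trans even-d (order-∣ root (c * p ^ s′) g^≡1)) ⟩
    0ℙ ∎)
    where
    open ≡-Reasoning
    even-d : 2 ∣ d
    even-d = ℕᵈ.divides (p ^ s′ * half) (φ≡half s′)
    c = a + b * pred d
    g^c≡1 : g ℤ.^ c ≡ 1ℤ [mod p ]
    g^c≡1 = mod-cancelˡ (Unit-^ b (mod-∣-Unit (order-Unit root))) (mod-trans (mod-sym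
      (mod-trans (mod-trans (mod-sym x≡g^b) x≡g^a)
        (mod-∣ p∣p^s (quotient-of-powers root b a mod-refl mod-refl))))
      (mod-reflexive (sym (ℤ.*-identityʳ _))))
      where
      mod-∣-Unit : ∀ {x} → Unit (p ^ suc s′) x → Unit p x
      mod-∣-Unit (unit x′ e) = unit x′ (mod-∣ p∣p^s e)
    g^≡1 : g ℤ.^ (c * p ^ s′) ≡ 1ℤ [mod p ^ suc s′ ]
    g^≡1 = mod-trans (mod-reflexive (sym (ℤ.^-*-assoc g c (p ^ s′)))) (^-lift-mod-^ s′ g^c≡1)

  -- Multiplicativity and uniqueness determine the class of y; in the parity group π is its own
  -- inverse, so dividing by x adds π.
  Class-*ʳ : ∀ {π ρ x y} → Class π x → Class ρ (x ℤ.* y) → Class (π ℙ.+ ρ) y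
  Class-*ʳ {π} {ρ} {x} {y} c cxy =
    let σ , cy = ∤⇒Class {y} (λ p∣y → Class⇒∤ cxy (ℤᵈ.∣n⇒∣m*n x p∣y))
    in subst (λ τ → Class τ y) (eq π ρ σ (Class-unique cxy (Class-* c cy))) cy
    where
    eq : ∀ π ρ σ → ρ ≡ π ℙ.+ σ → σ ≡ π ℙ.+ ρ
    eq 0ℙ ρ  σ refl = refl
    eq 1ℙ ρ  0ℙ refl = refl
    eq 1ℙ ρ  1ℙ refl = refl

  -- No search over exponents: the class of x is computed from the primitive root and compared with
  -- π, uniqueness settling the negative answer.
  Class? : ∀ π x → Dec (Class π x)
  Class? π x = decide (multiple? p x)
    where
    decide : Dec (+ p ∣ᶻ x) → Dec (Class π x)
    decide (yes p∣x) = no λ c → Class⇒∤ c p∣x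
    decide (no  p∤x) = let ρ , c = ∤⇒Class p∤x in
      map′ (λ ρ≡π → subst (λ σ → Class σ x) ρ≡π c) (Class-unique c) (ρ ℙ.≟ π)

  Class-periodic : ∀ π → Periodic p (λ x → ⟦ Class? π x ⟧)
  Class-periodic π a≡b = ⟦⟧-cong (Class-resp a≡b) (Class-resp (mod-sym a≡b)) (Class? π _) (Class? π _)

  -- Multiplication by g exchanges squares and non-squares. Adding the count to itself after the
  -- substitution y ↦ g y therefore counts all p - 1 units once.
  S-Class : S p (λ y → ⟦ Class? 1ℙ (+ y) ⟧) ≡ half
  S-Class = ℕ.*-cancelʳ-≡ _ _ 2 (begin
    S p (λ y → ⟦ Class? 1ℙ (+ y) ⟧) * 2
      ≡⟨ ℕ.*-comm (S p (λ y → ⟦ Class? 1ℙ (+ y) ⟧)) 2 ⟩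
    S p (λ y → ⟦ Class? 1ℙ (+ y) ⟧) + (S p (λ y → ⟦ Class? 1ℙ (+ y) ⟧) + 0)
      ≡⟨ cong₂ _+_ (sym (S-affine p (Class-periodic 1ℙ) unit-g 0ℤ)) (ℕ.+-identityʳ _) ⟩
    S p (λ y → ⟦ Class? 1ℙ (0ℤ ℤ.+ g ℤ.* + y) ⟧) + S p (λ y → ⟦ Class? 1ℙ (+ y) ⟧)
      ≡⟨ S-+ p _ _ ⟨
    S p (λ y → ⟦ Class? 1ℙ (0ℤ ℤ.+ g ℤ.* + y) ⟧ + ⟦ Class? 1ℙ (+ y) ⟧)
      ≡⟨ S-cong p (λ y → dichotomy (+ y)) ⟩
    S p (λ y → ⟦ ¬? (multiple? p (+ y)) ⟧)
      ≡⟨ S-nonmultiples p ⟩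
    p ∸ 1
      ≡⟨ half*2 ⟩
    half * 2 ∎)
    where
    open ≡-Reasoning
    unit-g : Unit p g
    unit-g = ∤⇒Unit prime-p (Class⇒∤ Class-g)
    g∤ : ∀ {y} → ∃ (λ π → Class π y) → ¬ Class 1ℙ (g ℤ.* y) → ¬ ¬ Class 1ℙ y
    g∤ (0ℙ , cy) ¬gy ¬cy = ¬gy (Class-* Class-g cy)
    g∤ (1ℙ , cy) ¬gy ¬cy = ¬cy cy
    1ℙ≢0ℙ : 1ℙ ≢ 0ℙ
    1ℙ≢0ℙ ()
    byCases : ∀ {y} (gy : Dec (Class 1ℙ (g ℤ.* y))) (cy : Dec (Class 1ℙ y)) (py : Dec (+ p ∣ᶻ y)) →
      ⟦ gy ⟧ + ⟦ cy ⟧ ≡ ⟦ ¬? py ⟧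
    byCases (yes gy) (yes cy) _        = contradiction (Class-unique gy (Class-* Class-g cy)) 1ℙ≢0ℙ
    byCases (yes gy) (no _)   (yes py) = contradiction (ℤᵈ.∣n⇒∣m*n g py) (Class⇒∤ gy)
    byCases (yes gy) (no _)   (no _)   = refl
    byCases (no _)   (yes cy) (yes py) = contradiction py (Class⇒∤ cy)
    byCases (no _)   (yes cy) (no _)   = refl
    byCases (no _)   (no _)   (yes _)  = refl
    byCases (no ¬gy) (no ¬cy) (no ¬py) = contradiction ¬cy (g∤ (∤⇒Class ¬py) ¬gy)
    dichotomy : ∀ y → ⟦ Class? 1ℙ (0ℤ ℤ.+ g ℤ.* y) ⟧ + ⟦ Class? 1ℙ y ⟧ ≡ ⟦ ¬? (multiple? p y) ⟧
    dichotomy y = trans (cong (λ z → ⟦ Class? 1ℙ z ⟧ + ⟦ Class? 1ℙ y ⟧) (ℤ.+-identityˡ (g ℤ.* y)))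
                        (byCases (Class? 1ℙ (g ℤ.* y)) (Class? 1ℙ y) (multiple? p y))

  module _ {l} (ord-l : HasOrder (p ^ suc s′) l (φ (p ^ suc s′) / 2)) where

    private
      ord-g : HasOrder (p ^ suc s′) g (φ (p ^ suc s′) / 2 * 2)
      ord-g = subst (HasOrder (p ^ suc s′) g) (trans (φ≡half s′) (cong (_* 2) (sym (φ/2 s′)))) root

      l-power : ∃ λ e → l ≡ g ℤ.^ e [mod p ^ suc s′ ]
      l-power = primitiveRoot-generates root (order-Unit ord-l)

    Class-l : Class 0ℙ l
    Class-l = let e , l≡g^e = l-power in
      class e (mod-∣ p∣p^s l≡g^e) (parity-even {e} (half-order-even ord-g ord-l e l≡g^e))

    -- The exponents of c and u modulo p^s both have parity π, as classes can be read modulo p. So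
    -- u/c is an even power of g, and hence a power of l.
    Class-quotient : ∀ {π c u} → Class π c → Class π u → ∃ λ r → u ≡ c ℤ.* l ℤ.^ r [mod p ^ suc s′ ]
    Class-quotient {π} {c} {u} cc cu =
      let a , c≡g^a = primitiveRoot-generates root (∤⇒Unit-^ prime-p s′ (Class⇒∤ cc))
          b , u≡g^b = primitiveRoot-generates root (∤⇒Unit-^ prime-p s′ (Class⇒∤ cu))
          even-e = even-parity (b + a * pred d) (begin
            parity (b + a * pred d) ≡⟨ parity-+-even b a d even-d ⟩
            parity b ℙ.+ parity a   ≡⟨ cong₂ ℙ._+_ (Class-unique (class b (mod-∣ p∣p^s u≡g^b) refl) cu)
                                                   (Class-unique (class a (mod-∣ p∣p^s c≡g^a) refl) cc) ⟩
            π ℙ.+ π                 ≡⟨ ℙ.p+p≡0ℙ π ⟩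
            0ℙ                      ∎)
          e , l≡g^e = l-power
          r , g^2≡l^r = half-order-generates-squares ord-g ord-l e l≡g^e (ℕᵈ.quotient even-e)
      in r , mod-trans (quotient-of-powers root a b c≡g^a u≡g^b) (mod-*-congˡ c
               (mod-trans (mod-reflexive (cong (g ℤ.^_) (ℕᵈ._∣_.equality even-e))) g^2≡l^r))
      where
      open ≡-Reasoning
      even-d : 2 ∣ d
      even-d = ℕᵈ.divides (p ^ s′ * half) (φ≡half s′)

-- Cyclotomic cosets and their products

module CosetSums (l n : ℕ) .{{_ : NonZero n}} where
  open Polynomial (ℤ/ l)

  -- Membership is extended from representatives to all integers, so that x - β or P w can be tested
  -- without reducing modulo n.
  Coset : ℤ → ℤ → Set
  Coset γ x = ∃ λ r → x ≡ γ ℤ.* (+ l) ℤ.^ r [mod n ]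

  Coset-resp : ∀ γ {x y} → x ≡ y [mod n ] → Coset γ x → Coset γ y
  Coset-resp γ x≡y (r , x≡γl^r) = r , mod-trans (mod-sym x≡y) x≡γl^r

  abstract
    Coset? : ∀ γ x → Dec (Coset γ x)
    Coset? γ x = map′ (Coset-resp γ (mod-sym x≡r)) (Coset-resp γ x≡r) (inCoset? l n γ r)
      where
      r : Fin n
      r = fromℕ< (n%ℕd<d x n)
      x≡r : x ≡ + toℕ r [mod n ]
      x≡r = mod-trans (mod-% n x) (mod-reflexive (cong +_ (sym (Fin.toℕ-fromℕ< (n%ℕd<d x n)))))

  Coset-periodic : ∀ γ → Periodic n (λ x → ⟦ Coset? γ x ⟧)
  Coset-periodic γ a≡b = ⟦⟧-cong (Coset-resp γ a≡b) (Coset-resp γ (mod-sym a≡b)) (Coset? γ _) (Coset? γ _)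

  sum-coset : ∀ γ (f : ℕ → ℕ) (h : Fin n → ℕ) → (∀ α → h α ≡ f (toℕ α)) →
    sum (map h (coset l n γ)) ≡ S n (λ α → ⟦ Coset? γ (+ α) ⟧ * f α)
  sum-coset γ f h eq = trans (sum-map-filter (inCoset? l n γ) h (allFin n))
    (sum-allFin n _ _ (λ α → cong₂ _*_ (⟦⟧-cong id id (inCoset? l n γ α) (Coset? γ (+ toℕ α))) (eq α)))

  S-δ : ∀ (f : ℕ → ℕ) k → S n (λ α → f α * ⟦ α ℕ.≟ k ⟧) ≡ ⟦ k <? n ⟧ * f k
  S-δ f k = byCases (k <? n)
    where
    byCases : (k<?n : Dec (k < n)) → S n (λ α → f α * ⟦ α ℕ.≟ k ⟧) ≡ ⟦ k<?n ⟧ * f k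
    byCases (yes k<n) = begin
      S n (λ α → f α * ⟦ α ℕ.≟ k ⟧) ≡⟨ S-single n k<n (λ {α} _ α≢k →
        trans (cong (f α *_) (⟦⟧-false (α ℕ.≟ k) α≢k)) (ℕ.*-zeroʳ (f α))) ⟩
      f k * ⟦ k ℕ.≟ k ⟧             ≡⟨ cong (f k *_) (⟦⟧-true (k ℕ.≟ k) refl) ⟩
      f k * 1                       ≡⟨ ℕ.*-comm (f k) 1 ⟩
      1 * f k                       ∎
      where open ≡-Reasoning
    byCases (no k≮n) = S-zero n (λ {α} α<n → trans
      (cong (f α *_) (⟦⟧-false (α ℕ.≟ k) (λ α≡k → k≮n (subst (_< n) α≡k α<n)))) (ℕ.*-zeroʳ (f α)))

  -- The factor `⟦ k <? n ⟧` is needed because the exponents stay below n, while `Coset?` is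
  -- periodic on all of ℤ.
  coeff-cosetSum : ∀ γ k → coeff (cosetSum l n γ) k ≡ + (⟦ k <? n ⟧ * ⟦ Coset? γ (+ k) ⟧)
  coeff-cosetSum γ k = trans (coeff-∑ l (coset l n γ) (λ α → coeff-X^ l (toℕ α) k))
    (cong +_ (trans (sum-coset γ (λ α → ⟦ α ℕ.≟ k ⟧) _ (λ _ → refl)) (S-δ (λ α → ⟦ Coset? γ (+ α) ⟧) k)))

  cosetProduct : ℤ → ℤ → Poly
  cosetProduct γ δ = ∑ (coset l n γ) (λ α → ∑ (coset l n δ) (λ β → X^ ((toℕ α + toℕ β) % n)))

  -- Given β, the other summand is determined modulo n, so decompositions x ≡ α + β are counted by β
  -- alone.
  representations : ℤ → ℤ → ℤ → ℕ
  representations γ δ x = S n (λ β → ⟦ Coset? δ (+ β) ⟧ * ⟦ Coset? γ (x ℤ.- + β) ⟧)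

  -- For k < n and fixed β, the only α with α + β ≡ k is the residue of k − β.
  ⟦+%≟⟧ : ∀ α β k → ⟦ (α + β) % n ℕ.≟ k ⟧ ≡ ⟦ k <? n ⟧ * ⟦ mod? n (+ α) (+ k ℤ.- + β) ⟧
  ⟦+%≟⟧ α β k = trans (⟦⟧-cong to from ((α + β) % n ℕ.≟ k) (k <? n ×-dec mod? n (+ α) (+ k ℤ.- + β)))
                      (⟦⟧-× (k <? n) (mod? n (+ α) (+ k ℤ.- + β)))
    where
    r≡α+β : + ((α + β) % n) ≡ + α ℤ.+ + β [mod n ]
    r≡α+β = mod-sym (mod-% n (+ (α + β)))
    moveˡ : ∀ a b c → c ℤ.- (a ℤ.+ b) ≡ ℤ.- (a ℤ.- (c ℤ.- b))
    moveˡ = solve-∀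
    moveʳ : ∀ a b c → ℤ.- (c ℤ.- (a ℤ.+ b)) ≡ a ℤ.- (c ℤ.- b)
    moveʳ = solve-∀
    to : (α + β) % n ≡ k → k < n × + α ≡ + k ℤ.- + β [mod n ]
    to refl = ℕ.m%n<n (α + β) n , congruent (subst (+ n ∣ᶻ_) (moveʳ (+ α) (+ β) (+ ((α + β) % n))) (ℤᵈ.∣m⇒∣-m (modulus∣difference r≡α+β)))
    from : k < n × + α ≡ + k ℤ.- + β [mod n ] → (α + β) % n ≡ k
    from (k<n , congruent d) = mod⇒≡ (ℕ.m%n<n (α + β) n) k<n (mod-trans r≡α+β
      (mod-sym (congruent (subst (+ n ∣ᶻ_) (sym (moveˡ (+ α) (+ β) (+ k))) (ℤᵈ.∣m⇒∣-m d)))))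

  coeff-cosetProduct : ∀ γ δ k → coeff (cosetProduct γ δ) k ≡ + (⟦ k <? n ⟧ * representations γ δ (+ k))
  coeff-cosetProduct γ δ k = trans
    (coeff-∑ l (coset l n γ) (λ α → coeff-∑ l (coset l n δ) (λ β → coeff-X^ l ((toℕ α + toℕ β) % n) k)))
    (cong +_ (begin
      sum (map (λ α → sum (map (λ β → ⟦ (toℕ α + toℕ β) % n ℕ.≟ k ⟧) (coset l n δ))) (coset l n γ))
        ≡⟨ sum-coset γ (λ α → S n (λ β → B β * ⟦ (α + β) % n ℕ.≟ k ⟧)) _ (λ α → sum-coset δ (λ β → ⟦ (toℕ α + β) % n ℕ.≟ k ⟧) _ (λ _ → refl)) ⟩
      S n (λ α → A α * S n (λ β → B β * ⟦ (α + β) % n ℕ.≟ k ⟧))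
        ≡⟨ S-cong n (λ α → trans (sym (S-*ˡ n (A α) _)) (S-cong n λ β →
             trans (cong (λ z → A α * (B β * z)) (⟦+%≟⟧ α β k)) (rearrange (A α) (B β) K ⟦ mod? n (+ α) (+ k ℤ.- + β) ⟧))) ⟩
      S n (λ α → S n (λ β → K * (B β * (⟦ mod? n (+ α) (+ k ℤ.- + β) ⟧ * A α))))
        ≡⟨ S-swap n n _ ⟩
      S n (λ β → S n (λ α → K * (B β * (⟦ mod? n (+ α) (+ k ℤ.- + β) ⟧ * A α))))
        ≡⟨ S-cong n (λ β → trans (S-*ˡ n K _) (cong (K *_) (trans (S-*ˡ n (B β) _)
             (cong (B β *_) (S-pick n (Coset-periodic γ) (+ k ℤ.- + β)))))) ⟩
      S n (λ β → K * (B β * ⟦ Coset? γ (+ k ℤ.- + β) ⟧))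
        ≡⟨ S-*ˡ n K _ ⟩
      K * representations γ δ (+ k) ∎))
    where
    open ≡-Reasoning
    A B : ℕ → ℕ
    A α = ⟦ Coset? γ (+ α) ⟧
    B β = ⟦ Coset? δ (+ β) ⟧
    K = ⟦ k <? n ⟧
    rearrange : ∀ a b k m → a * (b * (k * m)) ≡ k * (b * (m * a))
    rearrange = ℕ-solve-∀

  ⊗∼cosetProduct : ∀ γ δ → _∼_ l n (cosetSum l n γ ⊗ cosetSum l n δ) (cosetProduct γ δ)
  ⊗∼cosetProduct γ δ = ∑X^-⊗-∑X^ l n (coset l n γ) (coset l n δ) toℕ toℕ

  coeff-∑-cosetSum : ∀ {a} {P : ℕ → Set a} (P? : ∀ m → Dec (P m)) N (γ : ℕ → ℤ) k →
    coeff (∑ (filter P? (upTo N)) (λ m → cosetSum l n (γ m))) k ≡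
    + (⟦ k <? n ⟧ * S N (λ m → ⟦ P? m ⟧ * ⟦ Coset? (γ m) (+ k) ⟧))
  coeff-∑-cosetSum P? N γ k = trans (coeff-∑ l (filter P? (upTo N)) (λ m → coeff-cosetSum (γ m) k)) (cong +_ (begin
    sum (map (λ m → K * C m) (filter P? (upTo N)))   ≡⟨ sum-map-filter P? _ (upTo N) ⟩
    sum (map (λ m → ⟦ P? m ⟧ * (K * C m)) (upTo N))  ≡⟨ sum-upTo N _ ⟩
    S N (λ m → ⟦ P? m ⟧ * (K * C m))                 ≡⟨ S-cong N (λ m → swap ⟦ P? m ⟧ K (C m)) ⟩
    S N (λ m → K * (⟦ P? m ⟧ * C m))                 ≡⟨ S-*ˡ N K _ ⟩
    K * S N (λ m → ⟦ P? m ⟧ * C m)                   ∎))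
    where
    open ≡-Reasoning
    K = ⟦ k <? n ⟧
    C : ℕ → ℕ
    C m = ⟦ Coset? (γ m) (+ k) ⟧
    swap : ∀ a b c → a * (b * c) ≡ b * (a * c)
    swap = ℕ-solve-∀

-- The cosets modulo p^s q^t described by quadratic classes

pos-^ : ∀ m k → + (m ^ k) ≡ (+ m) ℤ.^ k
pos-^ m zero    = refl
pos-^ m (suc k) = trans (ℤ.pos-* m (m ^ k)) (cong (+ m ℤ.*_) (pos-^ m k))

distinct-primes⇒∤ : ∀ {p q} → Prime p → Prime q → p ≢ q → ¬ + p ∣ᶻ + q
distinct-primes⇒∤ prime-p prime-q p≢q p∣q with prime⇒irreducible prime-q (ℤᵈ.∣⇒∣ᵤ p∣q)
... | inj₁ p≡1 = prime≢1 prime-p p≡1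
... | inj₂ p≡q = p≢q p≡q

Unit-pos-^ : ∀ {m a} k → Unit m (+ a) → Unit m (+ (a ^ k))
Unit-pos-^ {m} {a} k u = subst (Unit m) (sym (pos-^ a k)) (Unit-^ k u)

mod-*-scale : ∀ {m a b} c → a ≡ b [mod m ] → + c ℤ.* a ≡ + c ℤ.* b [mod c * m ]
mod-*-scale {m} {a} {b} c (congruent m∣a-b) = congruent
  (subst₂ _∣ᶻ_ (sym (ℤ.pos-* c m)) (eq (+ c) a b) (ℤᵈ.*-monoʳ-∣ (+ c) m∣a-b))
  where
  eq : ∀ c a b → c ℤ.* (a ℤ.- b) ≡ c ℤ.* a ℤ.- c ℤ.* b
  eq = solve-∀

module CosetStructure
  (s′ t′ p q l : ℕ) (prime-p : Prime p) (prime-q : Prime q) (p≢q : p ≢ q)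
  (2∤p : ¬ 2 ∣ p) (p%4≡3 : p % 4 ≡ 3)
  (ord-p : HasOrder (p ^ suc s′) (+ l) (φ (p ^ suc s′) / 2))
  (ord-q : HasOrder (q ^ suc t′) (+ l) (φ (q ^ suc t′)))
  (gcd≡2 : gcd (φ (p ^ suc s′)) (φ (q ^ suc t′)) ≡ 2)
  (g : ℤ) (root-p : PrimitiveRoot (p ^ suc s′) g) (root-q : PrimitiveRoot (q ^ suc t′) g)
  where

  open QuadraticClasses prime-p 2∤p s′ root-p public

  n : ℕ
  n = p ^ suc s′ * q ^ suc t′

  instance
    p≢0 : NonZero p
    p≢0 = prime⇒nonZero prime-p
    q≢0 : NonZero q
    q≢0 = prime⇒nonZero prime-q
    p^s≢0 : NonZero (p ^ suc s′)
    p^s≢0 = ℕ.m^n≢0 p (suc s′)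
    q^t≢0 : NonZero (q ^ suc t′)
    q^t≢0 = ℕ.m^n≢0 q (suc t′)
    n≢0 : NonZero n
    n≢0 = ℕ.m*n≢0 (p ^ suc s′) (q ^ suc t′)

  open CosetSums l n public

  q∤p : ¬ + q ∣ᶻ + p
  q∤p = distinct-primes⇒∤ prime-q prime-p (p≢q ∘ sym)

  p∤q : ¬ + p ∣ᶻ + q
  p∤q = distinct-primes⇒∤ prime-p prime-q p≢q

  Unit-p^ : ∀ k → Unit q (+ (p ^ k))
  Unit-p^ k = Unit-pos-^ k (∤⇒Unit prime-q q∤p)

  Unit-p^-^ : ∀ b k → Unit (q ^ suc b) (+ (p ^ k))
  Unit-p^-^ b k = Unit-mod-^ b (Unit-p^ k)

  Unit⇒q∤ : ∀ {x} → Unit (q ^ suc t′) x → ¬ + q ∣ᶻ x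
  Unit⇒q∤ = Unit⇒∤ (prime≢1 prime-q) (ℕᵈ.m∣m*n (q ^ t′))

  q∤g : ¬ + q ∣ᶻ g
  q∤g = Unit⇒q∤ (order-Unit root-q)

  q∤1 : ¬ + q ∣ᶻ 1ℤ
  q∤1 = Unit⇒q∤ Unit-1

  -- For p = 4k + 3 the number (p-1)/2 equals 2k + 1.
  parity-half : parity half ≡ 1ℙ
  parity-half = trans (cong parity (ℕ.*-cancelʳ-≡ half (1 + k * 2) 2 (begin
    half * 2          ≡⟨ half*2 ⟨
    p ∸ 1             ≡⟨ cong (_∸ 1) (trans (ℕ.m≡m%n+[m/n]*n p 4) (cong (_+ k * 4) p%4≡3)) ⟩
    2 + k * 4         ≡⟨ eq k ⟩
    (1 + k * 2) * 2   ∎)))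
    (trans (ℙ.+-homo-+ 1 (k * 2)) (cong ℙ._⁻¹ (parity-even {k * 2} (ℕᵈ.n∣m*n k))))
    where
    open ≡-Reasoning
    k = p / 4
    eq : ∀ k → 2 + k * 4 ≡ (1 + k * 2) * 2
    eq = ℕ-solve-∀

  -- A common divisor divides both values of φ, hence their gcd 2; it is not 2, because φ(p^s)/2 =
  -- p^(s-1) (p-1)/2 is a product of odd numbers.
  coprime-orders : Coprime (φ (p ^ suc s′) / 2) (φ (q ^ suc t′))
  coprime-orders {d} (d∣h , d∣N) = oneOf (irreducible[2] (subst (d ∣_) gcd≡2 (gcd-greatest d∣φ d∣N)))
    where
    d∣half : d ∣ p ^ s′ * half
    d∣half = subst (d ∣_) (φ/2 s′) d∣h
    d∣φ : d ∣ φ (p ^ suc s′)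
    d∣φ = subst (d ∣_) (sym (φ≡half s′)) (ℕᵈ.∣m⇒∣m*n 2 d∣half)
    odd : ¬ 2 ∣ p ^ s′ * half
    odd 2∣h = ℙ.p≢p⁻¹ 1ℙ (trans (sym (trans (ℙ.*-homo-* (p ^ s′) half)
      (cong₂ ℙ._*_ (parity-^-odd s′ (parity-odd 2∤p)) parity-half))) (parity-even 2∣h))
    oneOf : d ≡ 1 ⊎ d ≡ 2 → d ≡ 1
    oneOf (inj₁ d≡1) = d≡1
    oneOf (inj₂ d≡2) = contradiction (subst (_∣ p ^ s′ * half) d≡2 d∣half) odd

  -- The Chinese remainder theorem is applied to the exponents, modulo the two coprime orders of l.
  l-power-CRT : ∀ r₁ r₂ → ∃ λ r → (+ l) ℤ.^ r ≡ (+ l) ℤ.^ r₁ [mod p ^ suc s′ ]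
                                × (+ l) ℤ.^ r ≡ (+ l) ℤ.^ r₂ [mod q ^ suc t′ ]
  l-power-CRT r₁ r₂ =
    let r , r≡r₁ , r≡r₂ = mod-CRT (Coprime⇒Unit coprime-orders) (+ r₁) (+ r₂)
    in r , order-cong ord-p r≡r₁ , order-cong ord-q r≡r₂
    where instance
      _ = >-nonZero (HasOrder.positive ord-p)
      _ = >-nonZero (HasOrder.positive ord-q)

  -- Treats C_{im} (cofactor 1, class `0ℙ`) and C*_{im} (cofactor g, class `1ℙ`) uniformly, so that
  -- their elements are described only once.
  record Representative (i m : ℕ) (π : Parity) (γ : ℤ) : Set where
    field
      cofactor       : ℤ
      γ≡             : γ ≡ + (p ^ i * q ^ m) ℤ.* cofactor
      class-cofactor : Class π cofactor
      q∤cofactor     : ¬ + q ∣ᶻ cofactor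

  representative-1 : ∀ i m → Representative i m 0ℙ (+ (p ^ i * q ^ m))
  representative-1 i m = record
    { cofactor = 1ℤ ; γ≡ = sym (ℤ.*-identityʳ _) ; class-cofactor = Class-1 ; q∤cofactor = q∤1 }

  representative-g : ∀ i m → Representative i m 1ℙ (+ (p ^ i * q ^ m) ℤ.* g)
  representative-g i m = record
    { cofactor = g ; γ≡ = refl ; class-cofactor = Class-g ; q∤cofactor = q∤g }

  -- The complementary factor visibly keeps a factor p, so classes survive reduction modulo it. No
  -- factor q is promised, since m = t is allowed.
  n≡ : ∀ {i m} → i ≤ s′ → m ≤ suc t′ → n ≡ p ^ i * q ^ m * (p ^ suc (s′ ∸ i) * q ^ (suc t′ ∸ m))
  n≡ {i} {m} i≤s′ m≤t = begin
    p ^ suc s′ * q ^ suc t′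
      ≡⟨ cong₂ (λ u v → p ^ u * q ^ v) (sym (trans (ℕ.+-suc i (s′ ∸ i)) (cong suc (ℕ.m+[n∸m]≡n i≤s′)))) (sym (ℕ.m+[n∸m]≡n m≤t)) ⟩
    p ^ (i + suc (s′ ∸ i)) * q ^ (m + (suc t′ ∸ m))
      ≡⟨ cong₂ _*_ (ℕ.^-distribˡ-+-* p i _) (ℕ.^-distribˡ-+-* q m _) ⟩
    p ^ i * p ^ suc (s′ ∸ i) * (q ^ m * q ^ (suc t′ ∸ m))
      ≡⟨ eq (p ^ i) (p ^ suc (s′ ∸ i)) (q ^ m) (q ^ (suc t′ ∸ m)) ⟩
    p ^ i * q ^ m * (p ^ suc (s′ ∸ i) * q ^ (suc t′ ∸ m)) ∎
    where
    open ≡-Reasoning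
    eq : ∀ a b c d → a * b * (c * d) ≡ a * c * (b * d)
    eq = ℕ-solve-∀

  module _ {i m π γ} (rep : Representative i m π γ) (i≤s′ : i ≤ s′) (m≤t : m ≤ suc t′) where
    open Representative rep

    private
      P = p ^ i * q ^ m
      M = p ^ suc (s′ ∸ i) * q ^ (suc t′ ∸ m)

    -- Dividing by P gives u ≡ cofactor · l^r modulo M. As p divides M and l is a square modulo p, u
    -- has the class of the cofactor; for m < t also q divides M, so u stays prime to q.
    Coset⇒ : ∀ {x} → Coset γ x → ∃ λ u → x ≡ + P ℤ.* u × Class π u × (m < suc t′ → ¬ + q ∣ᶻ u)
    Coset⇒ {x} (r , congruent (ℤᵈ.divides k x-γl^r≡kn)) = u , x≡Pu , class-u , q∤u
      where
      open ≡-Reasoning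
      y = cofactor ℤ.* (+ l) ℤ.^ r
      u = y ℤ.+ + M ℤ.* k
      restore : ∀ x y → x ≡ y ℤ.+ (x ℤ.- y)
      restore = solve-∀
      factor : ∀ P c l M k → P ℤ.* c ℤ.* l ℤ.+ k ℤ.* (P ℤ.* M) ≡ P ℤ.* (c ℤ.* l ℤ.+ M ℤ.* k)
      factor = solve-∀
      x≡Pu : x ≡ + P ℤ.* u
      x≡Pu = begin
        x ≡⟨ restore x (γ ℤ.* (+ l) ℤ.^ r) ⟩
        γ ℤ.* (+ l) ℤ.^ r ℤ.+ (x ℤ.- γ ℤ.* (+ l) ℤ.^ r)
          ≡⟨ cong₂ (λ a b → a ℤ.* (+ l) ℤ.^ r ℤ.+ b) γ≡ x-γl^r≡kn ⟩
        + P ℤ.* cofactor ℤ.* (+ l) ℤ.^ r ℤ.+ k ℤ.* + n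
          ≡⟨ cong (λ z → + P ℤ.* cofactor ℤ.* (+ l) ℤ.^ r ℤ.+ k ℤ.* z)
               (trans (cong +_ (n≡ i≤s′ m≤t)) (ℤ.pos-* P M)) ⟩
        + P ℤ.* cofactor ℤ.* (+ l) ℤ.^ r ℤ.+ k ℤ.* (+ P ℤ.* + M)
          ≡⟨ factor (+ P) cofactor _ (+ M) k ⟩
        + P ℤ.* u ∎
      u≡y : u ≡ y [mod M ]
      u≡y = mod-+multiple y k
      p∣M : p ∣ M
      p∣M = ℕᵈ.∣m⇒∣m*n _ (ℕᵈ.m∣m*n (p ^ (s′ ∸ i)))
      class-u : Class π u
      class-u = Class-resp (mod-sym (mod-∣ p∣M u≡y))
        (subst (λ ρ → Class ρ y) (ℙ.+-identityʳ π) (Class-* class-cofactor (Class-^ r (Class-l ord-p))))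
      q∤u : m < suc t′ → ¬ + q ∣ᶻ u
      q∤u m<t q∣u = Unit⇒∤ (prime≢1 prime-q) ℕᵈ.∣-refl
        (Unit-* (∤⇒Unit prime-q q∤cofactor) (Unit-^ r (∤⇒Unit prime-q (Unit⇒q∤ (order-Unit ord-q)))))
        (∣-resp-mod q∣M u≡y q∣u)
        where
        q∣M : q ∣ M
        q∣M = ℕᵈ.∣n⇒∣m*n (p ^ suc (s′ ∸ i))
          (subst (λ e → q ∣ q ^ e) (sym (ℕ.+-∸-assoc 1 (ℕ.≤-pred m<t))) (ℕᵈ.m∣m*n (q ^ (t′ ∸ m))))

    -- The quotient of u by the cofactor is a power of l modulo p^s and, for m < t, modulo q^t;
    -- `l-power-CRT` provides a common exponent.
    Coset⇐ : ∀ {u} → Class π u → (m < suc t′ → ¬ + q ∣ᶻ u) → Coset γ (+ P ℤ.* u)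
    Coset⇐ {u} class-u q∤u = byCases (m <? suc t′)
      where
      r₁ : ∃ λ r → u ≡ cofactor ℤ.* (+ l) ℤ.^ r [mod p ^ suc s′ ]
      r₁ = Class-quotient ord-p class-cofactor class-u
      γ-assoc : ∀ r → + P ℤ.* (cofactor ℤ.* (+ l) ℤ.^ r) ≡ γ ℤ.* (+ l) ℤ.^ r
      γ-assoc r = trans (sym (ℤ.*-assoc (+ P) cofactor _)) (cong (ℤ._* (+ l) ℤ.^ r) (sym γ≡))
      assemble : ∀ r → + P ℤ.* u ≡ + P ℤ.* (cofactor ℤ.* (+ l) ℤ.^ r) [mod p ^ suc s′ ] →
                       + P ℤ.* u ≡ + P ℤ.* (cofactor ℤ.* (+ l) ℤ.^ r) [mod q ^ suc t′ ] →
                       Coset γ (+ P ℤ.* u)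
      assemble r e₁ e₂ = r , mod-trans (mod-combine (Unit-p^-^ t′ (suc s′)) e₁ e₂) (mod-reflexive (γ-assoc r))
      byCases : Dec (m < suc t′) → Coset γ (+ P ℤ.* u)
      byCases (yes m<t) =
        let a , c≡l^a = primitiveRoot-generates ord-q (∤⇒Unit-^ prime-q t′ q∤cofactor)
            b , u≡l^b = primitiveRoot-generates ord-q (∤⇒Unit-^ prime-q t′ (q∤u m<t))
            r , l^r≡₁ , l^r≡₂ = l-power-CRT (proj₁ r₁) (b + a * pred (φ (q ^ suc t′)))
        in assemble r
             (mod-*-congˡ (+ P) (mod-trans (proj₂ r₁) (mod-*-congˡ cofactor (mod-sym l^r≡₁))))
             (mod-*-congˡ (+ P) (mod-trans (quotient-of-powers ord-q a b c≡l^a u≡l^b) (mod-*-congˡ cofactor (mod-sym l^r≡₂))))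
      -- Here m = t, so q^t divides P and both sides vanish modulo q^t: the trivial congruence
      -- modulo 1 is scaled by P.
      byCases (no m≮t) = assemble (proj₁ r₁) (mod-*-congˡ (+ P) (proj₂ r₁))
        (mod-∣ q^t∣P*1 (mod-*-scale P (congruent (ℤᵈ.divides (u ℤ.- cofactor ℤ.* (+ l) ℤ.^ proj₁ r₁) (sym (ℤ.*-identityʳ _))))))
        where
        q^t∣P*1 : q ^ suc t′ ∣ P * 1
        q^t∣P*1 = ℕᵈ.∣m⇒∣m*n 1 (ℕᵈ.∣n⇒∣m*n (p ^ i)
          (subst (λ e → q ^ suc t′ ∣ q ^ e) (ℕ.≤-antisym (ℕ.≮⇒≥ m≮t) m≤t) ℕᵈ.∣-refl))

-- Telescoping over powers of q, and the count modulo q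

-- With m = j + k, each term is T k - T (k+1), written additively to avoid truncated subtraction,
-- except the last, which is T k itself. Terms with m ≤ j are killed by the indicator.
S-telescope : ∀ j b (D T : ℕ → ℕ) →
  (∀ e → e < b → D (j + suc e) + T (suc (suc e)) ≡ T (suc e)) →
  D (j + suc b) ≡ T (suc b) →
  S (suc (j + suc b)) (λ m → ⟦ j <? m ⟧ * D m) ≡ T 1
S-telescope j b D T step last = begin
  S (suc (j + suc b)) f         ≡⟨ S-suc (j + suc b) f ⟩
  S (j + suc b) f + f (j + suc b) ≡⟨ cong₂ _+_ (cong (λ N → S N f) (ℕ.+-suc j b)) (trans (f≡D b) last) ⟩
  S (suc (j + b)) f + T (suc b) ≡⟨ partial b ℕ.≤-refl ⟩
  T 1                           ∎
  where
  open ≡-Reasoning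
  f : ℕ → ℕ
  f m = ⟦ j <? m ⟧ * D m
  f≡D : ∀ e → f (j + suc e) ≡ D (j + suc e)
  f≡D e = trans (cong (_* D (j + suc e)) (⟦⟧-true (j <? j + suc e) (ℕ.m<m+n j (s≤s z≤n)))) (ℕ.*-identityˡ _)
  partial : ∀ e → e ≤ b → S (suc (j + e)) f + T (suc e) ≡ T 1
  partial zero    _   = cong (_+ T 1) (S-zero (suc (j + 0)) λ {m} m<j+1 →
    cong (_* D m) (⟦⟧-false (j <? m) (ℕ.≤⇒≯ (ℕ.≤-pred (subst (m <_) (cong suc (ℕ.+-identityʳ j)) m<j+1)))))
  partial (suc e) e<b = begin
    S (suc (j + suc e)) f + T (suc (suc e))
      ≡⟨ cong (_+ T (suc (suc e))) (trans (S-suc (j + suc e) f) (cong₂ _+_ (cong (λ N → S N f) (ℕ.+-suc j e)) (f≡D e))) ⟩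
    S (suc (j + e)) f + D (j + suc e) + T (suc (suc e))
      ≡⟨ ℕ.+-assoc (S (suc (j + e)) f) _ _ ⟩
    S (suc (j + e)) f + (D (j + suc e) + T (suc (suc e)))
      ≡⟨ cong (_+_ (S (suc (j + e)) f)) (step e e<b) ⟩
    S (suc (j + e)) f + T (suc e)
      ≡⟨ partial e (ℕ.<⇒≤ e<b) ⟩
    T 1 ∎

module _ {q} (prime-q : Prime q) {c} (unit-c : Unit q c) where

  private
    instance _ = prime⇒nonZero prime-q
    avoid : ℤ → ℤ → ℕ
    avoid w y = ⟦ ¬? (multiple? q y) ⟧ * ⟦ ¬? (multiple? q (w ℤ.- c ℤ.* y)) ⟧

  avoid-periodic : ∀ w → Periodic q (avoid w)
  avoid-periodic w a≡b = cong₂ _*_ (nonmultiple-periodic q a≡b)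
    (nonmultiple-periodic q (mod-+-cong (mod-refl {a = w}) (mod-neg-cong (mod-*-congˡ c a≡b))))

  -- Modulo q the second argument is -c y, so the second condition follows from the first and only y
  -- ≡ 0 is lost.
  S-avoid-multiple : ∀ {w} → + q ∣ᶻ w → S q (λ y → avoid w (+ y)) ≡ q ∸ 1
  S-avoid-multiple {w} q∣w = trans
    (S-cong q λ y → absorb (+ y) (multiple? q (+ y)) (multiple? q (w ℤ.- c ℤ.* + y))) (S-nonmultiples q)
    where
    absorb : ∀ y (qy : Dec (+ q ∣ᶻ y)) (qz : Dec (+ q ∣ᶻ w ℤ.- c ℤ.* y)) → ⟦ ¬? qy ⟧ * ⟦ ¬? qz ⟧ ≡ ⟦ ¬? qy ⟧
    absorb y (yes _)  qz       = refl
    absorb y (no _)   (no _)   = refl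
    absorb y (no q∤y) (yes qz) = contradiction (cancel (ℤᵈ.∣m∣n⇒∣m-n q∣w qz)) q∤y
      where
      eq : ∀ w c y c′ → y ≡ c′ ℤ.* (w ℤ.- (w ℤ.- c ℤ.* y)) ℤ.+ ℤ.- y ℤ.* (c ℤ.* c′ ℤ.- 1ℤ)
      eq = solve-∀
      cancel : + q ∣ᶻ w ℤ.- (w ℤ.- c ℤ.* y) → + q ∣ᶻ y
      cancel d = subst (+ q ∣ᶻ_) (sym (eq w c y (Unit.inverse unit-c)))
        (∣-comb (Unit.inverse unit-c) (ℤ.- y) d (modulus∣difference (Unit.*-inverse unit-c)))

  -- The excluded residues y ≡ 0 and y ≡ w/c are distinct; their two indicators are added back to
  -- reach the full count q.
  S-avoid-nonmultiple : ∀ {w} → ¬ + q ∣ᶻ w → S q (λ y → avoid w (+ y)) ≡ q ∸ 2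
  S-avoid-nonmultiple {w} q∤w = begin
    S q (λ y → avoid w (+ y))
      ≡⟨ ℕ.m+n∸n≡m (S q (λ y → avoid w (+ y))) 2 ⟨
    S q (λ y → avoid w (+ y)) + (1 + 1) ∸ 2
      ≡⟨ cong (λ z → S q (λ y → avoid w (+ y)) + z ∸ 2) (sym (cong₂ _+_ (S-multiples-0 q) S-second)) ⟩
    S q (λ y → avoid w (+ y)) + (S q (λ y → ⟦ multiple? q (+ y) ⟧) + S q (λ y → ⟦ multiple? q (w ℤ.- c ℤ.* + y) ⟧)) ∸ 2
      ≡⟨ cong (_∸ 2) (trans (cong (_+_ (S q (λ y → avoid w (+ y)))) (sym (S-+ q _ _))) (sym (S-+ q _ _))) ⟩
    S q (λ y → avoid w (+ y) + (⟦ multiple? q (+ y) ⟧ + ⟦ multiple? q (w ℤ.- c ℤ.* + y) ⟧)) ∸ 2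
      ≡⟨ cong (_∸ 2) (S-cong q λ y → partition (+ y) (multiple? q (+ y)) (multiple? q (w ℤ.- c ℤ.* + y))) ⟩
    S q (λ y → 1) ∸ 2
      ≡⟨ cong (_∸ 2) (trans (S-const q 1) (ℕ.*-identityʳ q)) ⟩
    q ∸ 2 ∎
    where
    open ≡-Reasoning
    neg : ∀ w c y → w ℤ.+ ℤ.- c ℤ.* y ≡ w ℤ.- c ℤ.* y
    neg = solve-∀
    unit-neg : Unit q (ℤ.- c)
    unit-neg = unit (ℤ.- Unit.inverse unit-c)
      (mod-trans (mod-reflexive (eq c (Unit.inverse unit-c))) (Unit.*-inverse unit-c))
      where
      eq : ∀ c c′ → ℤ.- c ℤ.* ℤ.- c′ ≡ c ℤ.* c′
      eq = solve-∀
    S-second : S q (λ y → ⟦ multiple? q (w ℤ.- c ℤ.* + y) ⟧) ≡ 1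
    S-second = trans (S-cong q λ y → cong (λ z → ⟦ multiple? q z ⟧) (sym (neg w c (+ y)))) (S-multiples q unit-neg w)
    partition : ∀ y (qy : Dec (+ q ∣ᶻ y)) (qz : Dec (+ q ∣ᶻ w ℤ.- c ℤ.* y)) →
      ⟦ ¬? qy ⟧ * ⟦ ¬? qz ⟧ + (⟦ qy ⟧ + ⟦ qz ⟧) ≡ 1
    partition y (yes qy) (yes qz) = contradiction (subst (+ q ∣ᶻ_) (eq w c y) (∣-comb c 1ℤ qy qz)) q∤w
      where
      eq : ∀ w c y → c ℤ.* y ℤ.+ 1ℤ ℤ.* (w ℤ.- c ℤ.* y) ≡ w
      eq = solve-∀
    partition y (yes _) (no _)  = refl
    partition y (no _)  (yes _) = refl
    partition y (no _)  (no _)  = refl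

-- Counting the decompositions of an element

module CosetProduct
  (s′ t′ p q l : ℕ) (prime-p : Prime p) (prime-q : Prime q) (p≢q : p ≢ q)
  (2∤p : ¬ 2 ∣ p) (p%4≡3 : p % 4 ≡ 3)
  (ord-p : HasOrder (p ^ suc s′) (+ l) (φ (p ^ suc s′) / 2))
  (ord-q : HasOrder (q ^ suc t′) (+ l) (φ (q ^ suc t′)))
  (gcd≡2 : gcd (φ (p ^ suc s′)) (φ (q ^ suc t′)) ≡ 2)
  (g : ℤ) (root-p : PrimitiveRoot (p ^ suc s′) g) (root-q : PrimitiveRoot (q ^ suc t′) g)
  where

  open CosetStructure s′ t′ p q l prime-p prime-q p≢q 2∤p p%4≡3 ord-p ord-q gcd≡2 g root-p root-q public

  module _ {i i′ j} (i<i′ : i < i′) (i′≤s′ : i′ ≤ s′) (j≤t′ : j ≤ t′) {γ δ}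
    (rep-γ : Representative i j 1ℙ γ) (rep-δ : Representative i′ j 1ℙ δ) where

    private
      P P′ a b M e : ℕ
      P = p ^ i * q ^ j
      P′ = p ^ i′ * q ^ j
      a = s′ ∸ i′
      b = t′ ∸ j
      M = p ^ suc a * q ^ suc b
      e = i′ ∸ i
      i≤s′ : i ≤ s′
      i≤s′ = ℕ.≤-trans (ℕ.<⇒≤ i<i′) i′≤s′
      j<t : j < suc t′
      j<t = s≤s j≤t′
      j≤t : j ≤ suc t′
      j≤t = ℕ.<⇒≤ j<t
      instance
        P≢0 : NonZero P
        P≢0 = ℕ.m*n≢0 (p ^ i) (q ^ j) {{ℕ.m^n≢0 p i}} {{ℕ.m^n≢0 q j}}
        P′≢0 : NonZero P′
        P′≢0 = ℕ.m*n≢0 (p ^ i′) (q ^ j) {{ℕ.m^n≢0 p i′}} {{ℕ.m^n≢0 q j}}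
      p^e : ℤ
      p^e = + (p ^ e)

      P′≡P*p^e : + P′ ≡ + P ℤ.* p^e
      P′≡P*p^e = begin
        + (p ^ i′ * q ^ j)             ≡⟨ cong (λ k → + (p ^ k * q ^ j)) (ℕ.m+[n∸m]≡n (ℕ.<⇒≤ i<i′)) ⟨
        + (p ^ (i + e) * q ^ j)        ≡⟨ cong (λ k → + (k * q ^ j)) (ℕ.^-distribˡ-+-* p i e) ⟩
        + (p ^ i * p ^ e * q ^ j)      ≡⟨ cong +_ (eq (p ^ i) (p ^ e) (q ^ j)) ⟩
        + (P * p ^ e)                  ≡⟨ ℤ.pos-* P (p ^ e) ⟩
        + P ℤ.* p^e                    ∎
        where
        open ≡-Reasoning
        eq : ∀ x y z → x * y * z ≡ x * z * y
        eq = ℕ-solve-∀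

      n≡M*P′ : n ≡ M * P′
      n≡M*P′ = trans (n≡ i′≤s′ j≤t) (trans (cong (λ k → P′ * (p ^ suc a * q ^ k)) (ℕ.+-∸-assoc 1 j≤t′)) (ℕ.*-comm P′ M))

      p∣p^e : p ∣ p ^ e
      p∣p^e = subst (λ k → p ∣ p ^ k) (sym (ℕ.+-∸-assoc 1 i<i′)) (ℕᵈ.m∣m*n (p ^ (i′ ∸ suc i)))

    module _ {k π η} (rep : Representative k j π η) (k≤s′ : k ≤ s′) where
      private
        Q = p ^ k * q ^ j
        instance
          Q≢0 : NonZero Q
          Q≢0 = ℕ.m*n≢0 (p ^ k) (q ^ j) {{ℕ.m^n≢0 p k}} {{ℕ.m^n≢0 q j}}

      Coset⇒∣ : ∀ {x} → Coset η x → + Q ∣ᶻ x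
      Coset⇒∣ c = let u , x≡Qu , _ = Coset⇒ rep k≤s′ j≤t c
                  in ℤᵈ.divides u (trans x≡Qu (ℤ.*-comm (+ Q) u))

      ⟦Coset⟧ : ∀ w → ⟦ Coset? η (+ Q ℤ.* w) ⟧ ≡ ⟦ Class? π w ⟧ * ⟦ ¬? (multiple? q w) ⟧
      ⟦Coset⟧ w = trans (⟦⟧-cong to (λ (c , q∤w) → Coset⇐ rep k≤s′ j≤t c (λ _ → q∤w))
                          (Coset? η _) (Class? π w ×-dec ¬? (multiple? q w)))
                        (⟦⟧-× (Class? π w) (¬? (multiple? q w)))
        where
        to : Coset η (+ Q ℤ.* w) → Class π w × ¬ + q ∣ᶻ w
        to c = let u , Qw≡Qu , class-u , q∤u = Coset⇒ rep k≤s′ j≤t c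
                   u≡w = sym (ℤ.*-cancelˡ-≡ (+ Q) w u Qw≡Qu)
               in subst (Class π) u≡w class-u , subst (λ z → ¬ + q ∣ᶻ z) u≡w (q∤u j<t)

    -- Both factors are supported on multiples of P.
    representations-zero : ∀ {x} → ¬ + P ∣ᶻ x → representations γ δ x ≡ 0
    representations-zero {x} P∤x = S-zero n λ {β} _ → ⟦⟧-*-zero (Coset? δ (+ β)) (Coset? γ (x ℤ.- + β))
      λ δβ γx-β → P∤x (subst (+ P ∣ᶻ_) (eq x (+ β))
        (ℤᵈ.∣m∣n⇒∣m+n (Coset⇒∣ rep-γ i≤s′ γx-β) (ℤᵈ.∣-trans P∣P′ (Coset⇒∣ rep-δ i′≤s′ δβ))))
      where
      eq : ∀ x b → x ℤ.- b ℤ.+ b ≡ x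
      eq = solve-∀
      P∣P′ : + P ∣ᶻ + P′
      P∣P′ = ℤᵈ.divides p^e (trans P′≡P*p^e (ℤ.*-comm (+ P) p^e))

    avoiding : ℤ → ℤ → ℕ
    avoiding w y = ⟦ ¬? (multiple? q y) ⟧ * ⟦ ¬? (multiple? q (w ℤ.- p^e ℤ.* y)) ⟧

    -- With β = P′ v, the other summand is P (w - p^e v), whose cofactor has the class of w since p
    -- divides p^e; that indicator leaves the sum. What remains is a function of v modulo p times
    -- one modulo q. They run through p^a and q^b periods.
    representations-multiple : ∀ w → representations γ δ (+ P ℤ.* w) ≡
      ⟦ Class? 1ℙ w ⟧ * (p ^ a * half * (q ^ b * S q (λ y → avoiding w (+ y))))
    representations-multiple w = begin
      S n f
        ≡⟨ cong (λ N → S N f) n≡M*P′ ⟩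
      S (M * P′) f
        ≡⟨ S-* M P′ f ⟩
      S M (λ v → S P′ (λ r → f (v * P′ + r)))
        -- Each block of length P′ contributes only through r = 0, because C_δ consists of multiples
        -- of P′.
        ≡⟨ S-cong M (λ v → trans (S-single P′ (>-nonZero⁻¹ P′) (λ {r} → off-support v r)) (on-support v)) ⟩
      S M (λ v → ⟦ Class? 1ℙ w ⟧ * (F (+ v) * avoiding w (+ v)))
        ≡⟨ S-*ˡ M ⟦ Class? 1ℙ w ⟧ _ ⟩
      ⟦ Class? 1ℙ w ⟧ * S M (λ v → F (+ v) * avoiding w (+ v))
        ≡⟨ cong (⟦ Class? 1ℙ w ⟧ *_) (begin
          S M (λ v → F (+ v) * avoiding w (+ v))
            ≡⟨ cong (λ N → S N (λ v → F (+ v) * avoiding w (+ v))) (ℕ.*-comm (p ^ suc a) (q ^ suc b)) ⟩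
          S (q ^ suc b * p ^ suc a) (λ v → F (+ v) * avoiding w (+ v))
            ≡⟨ S-CRT (p ^ suc a) (q ^ suc b) {F} {avoiding w} (Periodic-∣ (ℕᵈ.m∣m*n (p ^ a)) (Class-periodic 1ℙ))
                 (Periodic-∣ (ℕᵈ.m∣m*n (q ^ b)) (avoid-periodic prime-q (Unit-p^ e) w)) (Unit-p^-^ b (suc a)) ⟩
          S (p ^ suc a) (λ v → F (+ v)) * S (q ^ suc b) (λ v → avoiding w (+ v))
            ≡⟨ cong₂ _*_
                 (trans (cong (λ N → S N (λ v → F (+ v))) (ℕ.*-comm p (p ^ a)))
                   (trans (S-periods (p ^ a) p {F} (Class-periodic 1ℙ)) (cong (p ^ a *_) S-Class)))
                 (trans (cong (λ N → S N (λ v → avoiding w (+ v))) (ℕ.*-comm q (q ^ b)))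
                   (S-periods (q ^ b) q {avoiding w} (avoid-periodic prime-q (Unit-p^ e) w))) ⟩
          p ^ a * half * (q ^ b * S q (λ y → avoiding w (+ y))) ∎) ⟩
      ⟦ Class? 1ℙ w ⟧ * (p ^ a * half * (q ^ b * S q (λ y → avoiding w (+ y)))) ∎
      where
      open ≡-Reasoning
      instance _ = ℕ.m^n≢0 q (suc b)
      f : ℕ → ℕ
      f β = ⟦ Coset? δ (+ β) ⟧ * ⟦ Coset? γ (+ P ℤ.* w ℤ.- + β) ⟧
      F : ℤ → ℕ
      F y = ⟦ Class? 1ℙ y ⟧
      off-support : ∀ v r → r < P′ → r ≢ 0 → f (v * P′ + r) ≡ 0
      off-support v r r<P′ r≢0 = cong (_* ⟦ Coset? γ (+ P ℤ.* w ℤ.- + (v * P′ + r)) ⟧)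
        (⟦⟧-false (Coset? δ _) λ c → r≢0 (mod⇒≡ r<P′ (>-nonZero⁻¹ P′)
          (mod-trans (mod-sym (mod-block P′ v r)) (multiple⇒≡0 (Coset⇒∣ rep-δ i′≤s′ c)))))
        where
        multiple⇒≡0 : ∀ {x} → + P′ ∣ᶻ x → x ≡ 0ℤ [mod P′ ]
        multiple⇒≡0 {x} d = congruent (subst (+ P′ ∣ᶻ_) (sym (ℤ.+-identityʳ x)) d)
      z : ℕ → ℤ
      z v = w ℤ.- p^e ℤ.* + v
      Pw-β : ∀ v → + P ℤ.* w ℤ.- + P′ ℤ.* + v ≡ + P ℤ.* z v
      Pw-β v = trans (cong (λ u → + P ℤ.* w ℤ.- u ℤ.* + v) P′≡P*p^e) (eq (+ P) w p^e (+ v))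
        where
        eq : ∀ P w c v → P ℤ.* w ℤ.- P ℤ.* c ℤ.* v ≡ P ℤ.* (w ℤ.- c ℤ.* v)
        eq = solve-∀
      z≡w : ∀ v → z v ≡ w [mod p ]
      z≡w v = congruent (subst (+ p ∣ᶻ_) (eq w p^e (+ v)) (ℤᵈ.∣n⇒∣m*n (ℤ.- + v) (+-∣ p∣p^e)))
        where
        eq : ∀ w c v → ℤ.- v ℤ.* c ≡ w ℤ.- c ℤ.* v ℤ.- w
        eq = solve-∀
      rearrange : ∀ a b c d → a * b * (c * d) ≡ c * (a * (b * d))
      rearrange = ℕ-solve-∀
      on-support : ∀ v → f (v * P′ + 0) ≡ ⟦ Class? 1ℙ w ⟧ * (F (+ v) * avoiding w (+ v))
      on-support v = begin
        f (v * P′ + 0)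
          ≡⟨ cong (λ β → ⟦ Coset? δ β ⟧ * ⟦ Coset? γ (+ P ℤ.* w ℤ.- β) ⟧) β≡ ⟩
        ⟦ Coset? δ (+ P′ ℤ.* + v) ⟧ * ⟦ Coset? γ (+ P ℤ.* w ℤ.- + P′ ℤ.* + v) ⟧
          ≡⟨ cong₂ _*_ (⟦Coset⟧ rep-δ i′≤s′ (+ v))
               (trans (cong (λ x → ⟦ Coset? γ x ⟧) (Pw-β v)) (trans (⟦Coset⟧ rep-γ i≤s′ (z v))
                 (cong (_* ⟦ ¬? (multiple? q (z v)) ⟧) (Class-periodic 1ℙ (z≡w v))))) ⟩
        F (+ v) * ⟦ ¬? (multiple? q (+ v)) ⟧ * (⟦ Class? 1ℙ w ⟧ * ⟦ ¬? (multiple? q (z v)) ⟧)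
          ≡⟨ rearrange (F (+ v)) _ ⟦ Class? 1ℙ w ⟧ _ ⟩
        ⟦ Class? 1ℙ w ⟧ * (F (+ v) * avoiding w (+ v)) ∎
        where
        β≡ : + (v * P′ + 0) ≡ + P′ ℤ.* + v
        β≡ = trans (cong +_ (trans (ℕ.+-identityʳ (v * P′)) (ℕ.*-comm v P′))) (ℤ.pos-* P′ v)

    -- D m is the indicator of whichever coset stands at level m, so both cases of the theorem are
    -- served at once. The parity equation says that q^(m-j) times a cofactor of class π is a
    -- non-square, κ being the class of q.
    module _ {κ} (class-q : Class κ (+ q)) (D : ℕ → ℤ → ℕ)
      (D-coset : ∀ k → j + suc k ≤ suc t′ → ∃₂ λ π η → Representative i (j + suc k) π η
                   × κ ℙ.* parity (suc k) ℙ.+ π ≡ 1ℙ × (∀ x → D (j + suc k) x ≡ ⟦ Coset? η x ⟧)) where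

      private
        power-split : ∀ k u → + (p ^ i * q ^ (j + k)) ℤ.* u ≡ + P ℤ.* (+ (q ^ k) ℤ.* u)
        power-split k u = begin
          + (p ^ i * q ^ (j + k)) ℤ.* u   ≡⟨ cong (λ z → + (p ^ i * z) ℤ.* u) (ℕ.^-distribˡ-+-* q j k) ⟩
          + (p ^ i * (q ^ j * q ^ k)) ℤ.* u ≡⟨ cong (λ z → + z ℤ.* u) (sym (ℕ.*-assoc (p ^ i) (q ^ j) (q ^ k))) ⟩
          + (P * q ^ k) ℤ.* u             ≡⟨ cong (ℤ._* u) (ℤ.pos-* P (q ^ k)) ⟩
          + P ℤ.* + (q ^ k) ℤ.* u         ≡⟨ ℤ.*-assoc (+ P) (+ (q ^ k)) u ⟩
          + P ℤ.* (+ (q ^ k) ℤ.* u)       ∎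
          where open ≡-Reasoning

        class-q^ : ∀ k → Class (κ ℙ.* parity k) (+ (q ^ k))
        class-q^ k = subst (Class (κ ℙ.* parity k)) (sym (pos-^ q k)) (Class-^ k class-q)

        +q^suc : ∀ k → + (q ^ suc k) ≡ + (q ^ k) ℤ.* + q
        +q^suc k = trans (cong +_ (ℕ.*-comm q (q ^ k))) (ℤ.pos-* (q ^ k) q)

      module _ {k π η} (rep : Representative i (j + k) π η) (parity≡ : κ ℙ.* parity k ℙ.+ π ≡ 1ℙ)
               (m≤t : j + k ≤ suc t′) where

        Coset⇒P∣ : ∀ {x} → Coset η x → + P ∣ᶻ x
        Coset⇒P∣ c = let u , x≡ , _ = Coset⇒ rep i≤s′ m≤t c
                     in ℤᵈ.divides (+ (q ^ k) ℤ.* u) (trans x≡ (trans (power-split k u) (ℤ.*-comm (+ P) _)))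

        -- Since q^(j+k) = q^j q^k, the element P w of the coset has w = q^k u with u of class π,
        -- and `parity≡` makes w a non-square.
        Coset-multiple⇒ : ∀ {w} → Coset η (+ P ℤ.* w) →
          Class 1ℙ w × + (q ^ k) ∣ᶻ w × (j + k < suc t′ → ¬ + (q ^ suc k) ∣ᶻ w)
        Coset-multiple⇒ {w} c =
            subst₂ Class parity≡ (sym w≡q^ku) (Class-* (class-q^ k) class-u)
          , ℤᵈ.divides u (trans w≡q^ku (ℤ.*-comm (+ (q ^ k)) u))
          , λ m<t q^k+1∣w → q∤u m<t (ℤᵈ.*-cancelˡ-∣ (+ (q ^ k)) {{ℕ.m^n≢0 q k}} (subst₂ _∣ᶻ_ (+q^suc k) w≡q^ku q^k+1∣w))
          where
          valuation = Coset⇒ rep i≤s′ m≤t c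
          u = proj₁ valuation
          class-u = proj₁ (proj₂ (proj₂ valuation))
          q∤u = proj₂ (proj₂ (proj₂ valuation))
          w≡q^ku : w ≡ + (q ^ k) ℤ.* u
          w≡q^ku = ℤ.*-cancelˡ-≡ (+ P) w _ (trans (proj₁ (proj₂ valuation)) (power-split k u))

        Coset-multiple⇐ : ∀ {w} → Class 1ℙ w → + (q ^ k) ∣ᶻ w →
          (j + k < suc t′ → ¬ + (q ^ suc k) ∣ᶻ w) → Coset η (+ P ℤ.* w)
        Coset-multiple⇐ {w} class-w (ℤᵈ.divides u w≡uq^k) q∤ = subst (Coset η) Qu≡Pw (Coset⇐ rep i≤s′ m≤t class-u
          λ m<t q∣u → q∤ m<t (subst₂ _∣ᶻ_ (sym (+q^suc k)) (sym w≡q^ku) (ℤᵈ.*-monoʳ-∣ (+ (q ^ k)) q∣u)))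
          where
          w≡q^ku : w ≡ + (q ^ k) ℤ.* u
          w≡q^ku = trans w≡uq^k (ℤ.*-comm u (+ (q ^ k)))
          Qu≡Pw : + (p ^ i * q ^ (j + k)) ℤ.* u ≡ + P ℤ.* w
          Qu≡Pw = trans (power-split k u) (cong (+ P ℤ.*_) (sym w≡q^ku))
          solve-parity : ∀ ρ π → ρ ℙ.+ π ≡ 1ℙ → ρ ℙ.+ 1ℙ ≡ π
          solve-parity 0ℙ 1ℙ _ = refl
          solve-parity 1ℙ 0ℙ _ = refl
          class-u : Class π u
          class-u = subst (λ ρ → Class ρ u) (solve-parity (κ ℙ.* parity k) π parity≡)
            (Class-*ʳ (class-q^ k) (subst (Class 1ℙ) w≡q^ku class-w))

      private
        -- The tail of the telescope: P w lies in a coset of level j + k or higher.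
        T? : ∀ w k → Dec (Class 1ℙ w × + (q ^ k) ∣ᶻ w)
        T? w k = Class? 1ℙ w ×-dec multiple? (q ^ k) w

        j+1+b≡t : j + suc b ≡ suc t′
        j+1+b≡t = trans (ℕ.+-suc j b) (cong suc (ℕ.m+[n∸m]≡n j≤t′))

        -- Below the top level, a non-square w divisible by q^(k+1) is either divisible exactly, and
        -- then P w is in the coset of level j + k + 1, or divisible by q^(k+2).
        D-step : ∀ w k → k < b → D (j + suc k) (+ P ℤ.* w) + ⟦ T? w (suc (suc k)) ⟧ ≡ ⟦ T? w (suc k) ⟧
        D-step w k k<b =
          let π , η , rep , parity≡ , D≡ = D-coset k (ℕ.<⇒≤ m<t)
          in trans (cong (_+ ⟦ T? w (suc (suc k)) ⟧) (D≡ (+ P ℤ.* w)))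
               (⟦⟧-split (T? w (suc k)) (Coset? η (+ P ℤ.* w)) (T? w (suc (suc k)))
                 (λ c → let cw , d , _ = Coset-multiple⇒ rep parity≡ (ℕ.<⇒≤ m<t) c in cw , d)
                 (λ (cw , d) → cw , ℤᵈ.∣-trans (+-∣ (ℕᵈ.n∣m*n q)) d)
                 (λ (cw , d) ¬T → Coset-multiple⇐ rep parity≡ (ℕ.<⇒≤ m<t) cw d λ _ d′ → ¬T (cw , d′))
                 (λ c (_ , d) → let _ , _ , ¬d = Coset-multiple⇒ rep parity≡ (ℕ.<⇒≤ m<t) c in ¬d m<t d))
          where
          m<t : j + suc k < suc t′
          m<t = subst (j + suc k <_) j+1+b≡t (ℕ.+-monoʳ-< j (s≤s k<b))

        -- At m = t no coprimality to q is imposed, so this coset takes the entire remaining tail.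
        D-last : ∀ w → D (j + suc b) (+ P ℤ.* w) ≡ ⟦ T? w (suc b) ⟧
        D-last w =
          let π , η , rep , parity≡ , D≡ = D-coset b m≤t
          in trans (D≡ (+ P ℤ.* w)) (⟦⟧-cong
               (λ c → let cw , d , _ = Coset-multiple⇒ rep parity≡ m≤t c in cw , d)
               (λ (cw , d) → Coset-multiple⇐ rep parity≡ m≤t cw d λ m<t → contradiction m<t (ℕ.≤⇒≯ (ℕ.≤-reflexive (sym j+1+b≡t))))
               (Coset? η (+ P ℤ.* w)) (T? w (suc b)))
          where
          m≤t : j + suc b ≤ suc t′
          m≤t = ℕ.≤-reflexive j+1+b≡t

      higherCosets : ℤ → ℕ
      higherCosets x = S (suc (suc t′)) (λ m → ⟦ j <? m ⟧ * D m x)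

      higherCosets-multiple : ∀ w → higherCosets (+ P ℤ.* w) ≡ ⟦ Class? 1ℙ w ⟧ * ⟦ multiple? q w ⟧
      higherCosets-multiple w = begin
        S (suc (suc t′)) (λ m → ⟦ j <? m ⟧ * D m (+ P ℤ.* w))
          ≡⟨ cong (λ N → S (suc N) (λ m → ⟦ j <? m ⟧ * D m (+ P ℤ.* w))) j+1+b≡t ⟨
        S (suc (j + suc b)) (λ m → ⟦ j <? m ⟧ * D m (+ P ℤ.* w))
          ≡⟨ S-telescope j b (λ m → D m (+ P ℤ.* w)) (λ k → ⟦ T? w k ⟧) (D-step w) (D-last w) ⟩
        ⟦ T? w 1 ⟧
          ≡⟨ ⟦⟧-× (Class? 1ℙ w) (multiple? (q ^ 1) w) ⟩
        ⟦ Class? 1ℙ w ⟧ * ⟦ multiple? (q ^ 1) w ⟧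
          ≡⟨ cong (λ r → ⟦ Class? 1ℙ w ⟧ * ⟦ multiple? r w ⟧) (ℕ.^-identityʳ q) ⟩
        ⟦ Class? 1ℙ w ⟧ * ⟦ multiple? q w ⟧ ∎
        where open ≡-Reasoning

      higherCosets-zero : ∀ {x} → ¬ + P ∣ᶻ x → higherCosets x ≡ 0
      higherCosets-zero {x} P∤x = S-zero (suc (suc t′)) λ {m} m<t+1 → term m (ℕ.≤-pred m<t+1) (j <? m)
        where
        term : ∀ m → m ≤ suc t′ → (j<?m : Dec (j < m)) → ⟦ j<?m ⟧ * D m x ≡ 0
        term m m≤t (no _)    = refl
        term m m≤t (yes j<m) =
          let k = m ∸ suc j
              j+1+k≡m = trans (ℕ.+-suc j k) (ℕ.m+[n∸m]≡n j<m)
              m≤t′ = subst (_≤ suc t′) (sym j+1+k≡m) m≤t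
              π , η , rep , parity≡ , D≡ = D-coset k m≤t′
          in trans (ℕ.*-identityˡ (D m x)) (trans (cong (λ m → D m x) (sym j+1+k≡m)) (trans (D≡ x)
               (⟦⟧-false (Coset? η x) (P∤x ∘ Coset⇒P∣ rep parity≡ m≤t′))))

      -- Let x = P w with w a non-square. If q does not divide w, only C_γ contains x, with weight
      -- from q - 2; if it does, only the higher levels do, with weight from q - 1. For all other x
      -- both sides vanish.
      representations-formula : ∀ x → representations γ δ x ≡
        p ^ a * half * (q ∸ 2) * q ^ b * ⟦ Coset? γ x ⟧ + p ^ a * half * (q ^ b * (q ∸ 1)) * higherCosets x
      representations-formula x = byDivisibility (multiple? P x)
        where
        open ≡-Reasoning
        A B : ℕ
        A = p ^ a * half * (q ∸ 2) * q ^ b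
        B = p ^ a * half * (q ^ b * (q ∸ 1))
        byClass : ∀ w (cw : Dec (Class 1ℙ w)) (qw : Dec (+ q ∣ᶻ w)) →
          ⟦ cw ⟧ * (p ^ a * half * (q ^ b * S q (λ y → avoiding w (+ y)))) ≡
          A * (⟦ cw ⟧ * ⟦ ¬? qw ⟧) + B * (⟦ cw ⟧ * ⟦ qw ⟧)
        byClass w (no _)  qw       = sym (cong₂ _+_ (ℕ.*-zeroʳ A) (ℕ.*-zeroʳ B))
        byClass w (yes _) (yes qw) = trans
          (cong (λ z → 1 * (p ^ a * half * (q ^ b * z))) (S-avoid-multiple prime-q (Unit-p^ e) qw))
          (eq A B)
          where
          eq : ∀ A B → 1 * B ≡ A * 0 + B * 1
          eq = ℕ-solve-∀
        byClass w (yes _) (no ¬qw) = trans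
          (cong (λ z → 1 * (p ^ a * half * (q ^ b * z))) (S-avoid-nonmultiple prime-q (Unit-p^ e) ¬qw))
          (eq (p ^ a * half) (q ^ b) (q ∸ 2) B)
          where
          eq : ∀ h u v B → 1 * (h * (u * v)) ≡ h * v * u * 1 + B * 0
          eq = ℕ-solve-∀
        byDivisibility : Dec (+ P ∣ᶻ x) → representations γ δ x ≡ A * ⟦ Coset? γ x ⟧ + B * higherCosets x
        byDivisibility (no P∤x) = begin
          representations γ δ x
            ≡⟨ representations-zero P∤x ⟩
          0
            ≡⟨ sym (cong₂ _+_ (ℕ.*-zeroʳ A) (ℕ.*-zeroʳ B)) ⟩
          A * 0 + B * 0
            ≡⟨ sym (cong₂ (λ u v → A * u + B * v) (⟦⟧-false (Coset? γ x) (P∤x ∘ Coset⇒∣ rep-γ i≤s′)) (higherCosets-zero P∤x)) ⟩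
          A * ⟦ Coset? γ x ⟧ + B * higherCosets x ∎
        byDivisibility (yes (ℤᵈ.divides w x≡wP)) = subst
          (λ x → representations γ δ x ≡ A * ⟦ Coset? γ x ⟧ + B * higherCosets x)
          (trans (ℤ.*-comm (+ P) w) (sym x≡wP)) (begin
            representations γ δ (+ P ℤ.* w)
              ≡⟨ representations-multiple w ⟩
            ⟦ Class? 1ℙ w ⟧ * (p ^ a * half * (q ^ b * S q (λ y → avoiding w (+ y))))
              ≡⟨ byClass w (Class? 1ℙ w) (multiple? q w) ⟩
            A * (⟦ Class? 1ℙ w ⟧ * ⟦ ¬? (multiple? q w) ⟧) + B * (⟦ Class? 1ℙ w ⟧ * ⟦ multiple? q w ⟧)
              ≡⟨ sym (cong₂ (λ u v → A * u + B * v) (⟦Coset⟧ rep-γ i≤s′ w) (higherCosets-multiple w)) ⟩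
            A * ⟦ Coset? γ (+ P ℤ.* w) ⟧ + B * higherCosets (+ P ℤ.* w) ∎)

-- The quadratic character of q and the two product formulas

-- Squaring doubles the exponent of g, whatever the class of the root.
quadraticResidue⇒Class : ∀ {p q} (prime-p : Prime p) (2∤p : ¬ 2 ∣ p) {g} s′ (root : PrimitiveRoot (p ^ suc s′) g) →
  ¬ + p ∣ᶻ + q → QuadraticResidue p q → QuadraticClasses.Class prime-p 2∤p s′ root 0ℙ (+ q)
quadraticResidue⇒Class {p} {q} prime-p 2∤p s′ root p∤q (_ , x , x²≡q) =
  let π , cx = ∤⇒Class p∤x
  in Class-resp x²≡q (subst (λ ρ → Class ρ (x ℤ.^ 2)) (ℙ.*-zeroʳ π) (Class-^ 2 cx))
  where
  open QuadraticClasses prime-p 2∤p s′ root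
  p∤x : ¬ + p ∣ᶻ x
  p∤x p∣x = p∤q (∣-resp-mod ℕᵈ.∣-refl x²≡q (ℤᵈ.∣m⇒∣m*n (x ℤ.^ 1) p∣x))

-- An even exponent 2f would make g^f a square root of q.
quadraticNonresidue⇒Class : ∀ {p q} (prime-p : Prime p) (2∤p : ¬ 2 ∣ p) {g} s′ (root : PrimitiveRoot (p ^ suc s′) g) →
  ¬ + p ∣ᶻ + q → QuadraticNonresidue p q → QuadraticClasses.Class prime-p 2∤p s′ root 1ℙ (+ q)
quadraticNonresidue⇒Class {p} {q} prime-p 2∤p {g} s′ root p∤q (_ , nonsquare) = odd (∤⇒Class p∤q)
  where
  open QuadraticClasses prime-p 2∤p s′ root
  square : ∀ {k} → 2 ∣ k → + q ≡ g ℤ.^ k [mod p ] → ∃ λ x → x ℤ.^ 2 ≡ + q [mod p ]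
  square (ℕᵈ.divides f refl) q≡ = g ℤ.^ f , mod-trans (mod-reflexive (ℤ.^-*-assoc g f 2)) (mod-sym q≡)
  odd : (∃ λ π → Class π (+ q)) → Class 1ℙ (+ q)
  odd (1ℙ , c) = c
  odd (0ℙ , class k q≡g^k eq) = contradiction (square (even-parity k eq) q≡g^k) nonsquare

theorem4p14 : (s t p q l : ℕ) → 1 ≤ s → 1 ≤ t →
    Prime p → Prime q → Prime l → p ≢ q → p ≢ l → q ≢ l →
    ¬ (2 ∣ p) → ¬ (2 ∣ q) → p % 4 ≡ 3 →
    HasOrder (p ^ s) (+ l) (φ (p ^ s) / 2) →
    HasOrder (q ^ t) (+ l) (φ (q ^ t)) →
    gcd (φ (p ^ s)) (φ (q ^ t)) ≡ 2 →
    (g : ℤ) → PrimitiveRoot (p ^ s) g → PrimitiveRoot (q ^ t) g →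
    (i i′ j : ℕ) → i < i′ → i′ ≤ s ∸ 1 → j ≤ t ∸ 1 →
    let open Polynomial (ℤ/ l)
        x^n-1 = X^ (p ^ s * q ^ t) ⊖ X^ 0
        X = χ p q l s t
        X* = χ* p q l s t g
        a = + (φ (p ^ (s ∸ i′)) / 2) ℤ.* (+ q ℤ.- + 2) ℤ.* + (q ^ (t ∸ j ∸ 1))
        b = + (φ (p ^ (s ∸ i′)) / 2) ℤ.* + φ (q ^ (t ∸ j))
    in
    (QuadraticResidue p q →
      (X* i j ⊗ X* i′ j)
        ≈ (a · X* i j ⊕ b · ∑ (filter (λ m → j <? m) (upTo (suc t))) (λ m → X* i m))
        [mod⟨ x^n-1 ⟩])
    ×
    (QuadraticNonresidue p q →
      (X* i j ⊗ X* i′ j)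
        ≈ (a · X* i j ⊕ b ·
            (∑ (filter (λ m → (j <? m) ×-dec ¬? (2 ∣? (m ∸ j))) (upTo (suc t))) (λ m → X i m)
             ⊕ ∑ (filter (λ m → (j <? m) ×-dec (2 ∣? (m ∸ j))) (upTo (suc t))) (λ m → X* i m)))
        [mod⟨ x^n-1 ⟩])
theorem4p14 (suc s′) (suc t′) p q l _ _ prime-p prime-q _ p≢q _ _ 2∤p _ p%4≡3 ord-p ord-q gcd≡2
  g root-p root-q i i′ j i<i′ i′≤s′ j≤t′ = residue , nonresidue
  where
  open Polynomial (ℤ/ l)
  open CosetProduct s′ t′ p q l prime-p prime-q p≢q 2∤p p%4≡3 ord-p ord-q gcd≡2 g root-p root-q

  X X* : ℕ → ℕ → Poly
  X  = χ p q l (suc s′) (suc t′)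
  X* = χ* p q l (suc s′) (suc t′) g

  γ γ* : ℕ → ℤ
  γ m  = + (p ^ i * q ^ m)
  γ* m = γ m ℤ.* g

  a b : ℤ
  a = + (φ (p ^ (suc s′ ∸ i′)) / 2) ℤ.* (+ q ℤ.- + 2) ℤ.* + (q ^ (suc t′ ∸ j ∸ 1))
  b = + (φ (p ^ (suc s′ ∸ i′)) / 2) ℤ.* + φ (q ^ (suc t′ ∸ j))

  A B : ℕ
  A = p ^ (s′ ∸ i′) * half * (q ∸ 2) * q ^ (t′ ∸ j)
  B = p ^ (s′ ∸ i′) * half * (q ^ (t′ ∸ j) * (q ∸ 1))

  φ/2≡ : φ (p ^ (suc s′ ∸ i′)) / 2 ≡ p ^ (s′ ∸ i′) * half
  φ/2≡ = trans (cong (λ k → φ (p ^ k) / 2) (ℕ.+-∸-assoc 1 i′≤s′)) (φ/2 (s′ ∸ i′))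

  suc[t′]∸j : suc t′ ∸ j ≡ suc (t′ ∸ j)
  suc[t′]∸j = ℕ.+-∸-assoc 1 j≤t′

  -- A prime is at least 2, so the integer coefficient agrees with the truncated subtraction of the
  -- count.
  q-2 : + q ℤ.- + 2 ≡ + (q ∸ 2)
  q-2 = trans (ℤ.m-n≡m⊖n q 2) (ℤ.⊖-≥ (nonTrivial⇒n>1 q {{prime⇒nonTrivial prime-q}}))

  a≡A : a ≡ + A
  a≡A = begin
    a ≡⟨ cong₂ (λ u v → + u ℤ.* v ℤ.* + (q ^ (suc t′ ∸ j ∸ 1))) φ/2≡ q-2 ⟩
    + (p ^ (s′ ∸ i′) * half) ℤ.* + (q ∸ 2) ℤ.* + (q ^ (suc t′ ∸ j ∸ 1))
      ≡⟨ cong (λ k → + (p ^ (s′ ∸ i′) * half) ℤ.* + (q ∸ 2) ℤ.* + (q ^ (k ∸ 1))) suc[t′]∸j ⟩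
    + (p ^ (s′ ∸ i′) * half) ℤ.* + (q ∸ 2) ℤ.* + (q ^ (t′ ∸ j))
      ≡⟨ cong (ℤ._* + (q ^ (t′ ∸ j))) (ℤ.pos-* (p ^ (s′ ∸ i′) * half) (q ∸ 2)) ⟨
    + (p ^ (s′ ∸ i′) * half * (q ∸ 2)) ℤ.* + (q ^ (t′ ∸ j))
      ≡⟨ ℤ.pos-* (p ^ (s′ ∸ i′) * half * (q ∸ 2)) (q ^ (t′ ∸ j)) ⟨
    + A ∎
    where open ≡-Reasoning

  b≡B : b ≡ + B
  b≡B = trans (cong₂ (λ u v → + u ℤ.* + v) φ/2≡ (trans (cong (λ k → φ (q ^ k)) suc[t′]∸j) (φ-prime-power prime-q (t′ ∸ j))))
              (sym (ℤ.pos-* (p ^ (s′ ∸ i′) * half) (q ^ (t′ ∸ j) * (q ∸ 1))))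

  -- The two cases differ only in the inner sum F. Given its coefficients H, the formula reduces to
  -- an identity between counts.
  product-formula : ∀ F (H : ℤ → ℕ) →
    (∀ k → coeff F k ≡ + (⟦ k <? n ⟧ * H (+ k))) →
    (∀ x → representations (γ* j) (+ (p ^ i′ * q ^ j) ℤ.* g) x ≡ A * ⟦ Coset? (γ* j) x ⟧ + B * H x) →
    (X* i j ⊗ X* i′ j) ≈ (a · X* i j ⊕ b · F) [mod⟨ X^ n ⊖ X^ 0 ⟩]
  product-formula F H coeff-F count = ∼⇒≈ l n (∼-trans l n
    (⊗∼cosetProduct (γ* j) (+ (p ^ i′ * q ^ j) ℤ.* g)) (∼-reflexive l n λ k → begin
      coeff (cosetProduct (γ* j) (+ (p ^ i′ * q ^ j) ℤ.* g)) k
        ≡⟨ coeff-cosetProduct (γ* j) _ k ⟩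
      + (⟦ k <? n ⟧ * representations (γ* j) (+ (p ^ i′ * q ^ j) ℤ.* g) (+ k))
        ≡⟨ cong (λ z → + (⟦ k <? n ⟧ * z)) (count (+ k)) ⟩
      + (⟦ k <? n ⟧ * (A * ⟦ Coset? (γ* j) (+ k) ⟧ + B * H (+ k)))
        ≡⟨ cong +_ (distribute ⟦ k <? n ⟧ A _ B _) ⟩
      + (A * (⟦ k <? n ⟧ * ⟦ Coset? (γ* j) (+ k) ⟧) + B * (⟦ k <? n ⟧ * H (+ k)))
        ≡⟨ cong₂ ℤ._+_ (ℤ.pos-* A _) (ℤ.pos-* B _) ⟩
      + A ℤ.* + (⟦ k <? n ⟧ * ⟦ Coset? (γ* j) (+ k) ⟧) ℤ.+ + B ℤ.* + (⟦ k <? n ⟧ * H (+ k))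
        ≡⟨ sym (cong₂ ℤ._+_ (cong₂ ℤ._*_ a≡A (coeff-cosetSum (γ* j) k)) (cong₂ ℤ._*_ b≡B (coeff-F k))) ⟩
      a ℤ.* coeff (X* i j) k ℤ.+ b ℤ.* coeff F k
        ≡⟨ sym (cong₂ ℤ._+_ (coeff-· l a (X* i j) k) (coeff-· l b F k)) ⟩
      coeff (a · X* i j) k ℤ.+ coeff (b · F) k
        ≡⟨ sym (coeff-⊕ l (a · X* i j) (b · F) k) ⟩
      coeff (a · X* i j ⊕ b · F) k ∎))
    where
    open ≡-Reasoning
    distribute : ∀ K A x B y → K * (A * x + B * y) ≡ A * (K * x) + B * (K * y)
    distribute = ℕ-solve-∀

  residue : QuadraticResidue p q → _
  residue qr = product-formula _ (higherCosets i<i′ i′≤s′ j≤t′ rep-γ rep-δ class-q D D-coset)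
    (coeff-∑-cosetSum (λ m → j <? m) (suc (suc t′)) γ*)
    (representations-formula i<i′ i′≤s′ j≤t′ rep-γ rep-δ class-q D D-coset)
    where
    rep-γ = representative-g i j
    rep-δ = representative-g i′ j
    class-q : Class 0ℙ (+ q)
    class-q = quadraticResidue⇒Class prime-p 2∤p s′ root-p p∤q qr
    D : ℕ → ℤ → ℕ
    D m x = ⟦ Coset? (γ* m) x ⟧
    D-coset : ∀ k → j + suc k ≤ suc t′ → ∃₂ λ π η → Representative i (j + suc k) π η
                × 0ℙ ℙ.* parity (suc k) ℙ.+ π ≡ 1ℙ × (∀ x → D (j + suc k) x ≡ ⟦ Coset? η x ⟧)
    -- All powers of q are squares modulo p, so the cofactor must be a non-square at every level;
    -- the parity equation holds by computation.
    D-coset k _ = 1ℙ , γ* (j + suc k) , representative-g i (j + suc k) , refl , λ x → refl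

  nonresidue : QuadraticNonresidue p q → _
  nonresidue qn = product-formula (F₁ ⊕ F₂) (higherCosets i<i′ i′≤s′ j≤t′ rep-γ rep-δ class-q D D-coset)
    coeff-F (representations-formula i<i′ i′≤s′ j≤t′ rep-γ rep-δ class-q D D-coset)
    where
    rep-γ = representative-g i j
    rep-δ = representative-g i′ j
    class-q : Class 1ℙ (+ q)
    class-q = quadraticNonresidue⇒Class prime-p 2∤p s′ root-p p∤q qn
    D : ℕ → ℤ → ℕ
    D m x = ⟦ ¬? (2 ∣? (m ∸ j)) ⟧ * ⟦ Coset? (γ m) x ⟧ + ⟦ 2 ∣? (m ∸ j) ⟧ * ⟦ Coset? (γ* m) x ⟧
    D-coset : ∀ k → j + suc k ≤ suc t′ → ∃₂ λ π η → Representative i (j + suc k) π η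
                × 1ℙ ℙ.* parity (suc k) ℙ.+ π ≡ 1ℙ × (∀ x → D (j + suc k) x ≡ ⟦ Coset? η x ⟧)
    -- For even m - j the power q^(m-j) is a square and the cofactor must be a non-square, giving
    -- C*_{im}; for odd m - j it is a non-square and the cofactor must be a square, giving C_{im}.
    D-coset k _ = byParity (2 ∣? (m ∸ j))
      where
      m = j + suc k
      m∸j≡ : m ∸ j ≡ suc k
      m∸j≡ = ℕ.m+n∸m≡n j (suc k)
      byParity : (even? : Dec (2 ∣ m ∸ j)) → ∃₂ λ π η → Representative i m π η
        × 1ℙ ℙ.* parity (suc k) ℙ.+ π ≡ 1ℙ
        × (∀ x → ⟦ ¬? even? ⟧ * ⟦ Coset? (γ m) x ⟧ + ⟦ even? ⟧ * ⟦ Coset? (γ* m) x ⟧ ≡ ⟦ Coset? η x ⟧)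
      byParity (yes 2∣) = 1ℙ , γ* m , representative-g i m
        , cong (ℙ._+ 1ℙ) (parity-even (subst (2 ∣_) m∸j≡ 2∣)) , λ x → ℕ.*-identityˡ _
      byParity (no 2∤)  = 0ℙ , γ m , representative-1 i m
        , cong (ℙ._+ 0ℙ) (parity-odd (2∤ ∘ subst (2 ∣_) (sym m∸j≡)))
        , λ x → trans (ℕ.+-identityʳ _) (ℕ.*-identityˡ _)
    F₁ F₂ : Poly
    F₁ = ∑ (filter (λ m → (j <? m) ×-dec ¬? (2 ∣? (m ∸ j))) (upTo (suc (suc t′)))) (λ m → X i m)
    F₂ = ∑ (filter (λ m → (j <? m) ×-dec (2 ∣? (m ∸ j))) (upTo (suc (suc t′)))) (λ m → X* i m)
    coeff-F : ∀ k → coeff (F₁ ⊕ F₂) k ≡ + (⟦ k <? n ⟧ * S (suc (suc t′)) (λ m → ⟦ j <? m ⟧ * D m (+ k)))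
    coeff-F k = begin
      coeff (F₁ ⊕ F₂) k
        ≡⟨ coeff-⊕ l F₁ F₂ k ⟩
      coeff F₁ k ℤ.+ coeff F₂ k
        ≡⟨ cong₂ ℤ._+_ (coeff-∑-cosetSum (λ m → (j <? m) ×-dec ¬? (2 ∣? (m ∸ j))) N γ k)
                       (coeff-∑-cosetSum (λ m → (j <? m) ×-dec (2 ∣? (m ∸ j))) N γ* k) ⟩
      + (K * S N f₁ + K * S N f₂)
        ≡⟨ cong +_ (sym (trans (cong (K *_) (S-+ N f₁ f₂)) (ℕ.*-distribˡ-+ K (S N f₁) (S N f₂)))) ⟩
      + (K * S N (λ m → f₁ m + f₂ m))
        ≡⟨ cong (λ z → + (K * z)) (S-cong N λ m → trans
             (cong₂ (λ u v → u * ⟦ Coset? (γ m) (+ k) ⟧ + v * ⟦ Coset? (γ* m) (+ k) ⟧)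
               (⟦⟧-× (j <? m) (¬? (2 ∣? (m ∸ j)))) (⟦⟧-× (j <? m) (2 ∣? (m ∸ j))))
             (collect ⟦ j <? m ⟧ ⟦ ¬? (2 ∣? (m ∸ j)) ⟧ ⟦ 2 ∣? (m ∸ j) ⟧ ⟦ Coset? (γ m) (+ k) ⟧ ⟦ Coset? (γ* m) (+ k) ⟧)) ⟩
      + (K * S N (λ m → ⟦ j <? m ⟧ * D m (+ k))) ∎
      where
      open ≡-Reasoning
      N = suc (suc t′)
      K = ⟦ k <? n ⟧
      f₁ f₂ : ℕ → ℕ
      f₁ m = ⟦ (j <? m) ×-dec ¬? (2 ∣? (m ∸ j)) ⟧ * ⟦ Coset? (γ m) (+ k) ⟧
      f₂ m = ⟦ (j <? m) ×-dec (2 ∣? (m ∸ j)) ⟧ * ⟦ Coset? (γ* m) (+ k) ⟧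
      collect : ∀ j u v x y → j * u * x + j * v * y ≡ j * (u * x + v * y)
      collect = ℕ-solve-∀
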